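{- For $n\ge0$ define $\Phi,\ \mathrm F_3:\mathfrak S_n\to\mathfrak S_n$ by $\Phi(\sigma)=\mathrm{ZDer}^{ -1}({\bf\Phi}(\mathrm{ZDer}(\sigma)))$ and $\mathrm F_3(\sigma)=\mathrm{ZDer}^{ -1}({\bf F}_3(\mathrm{ZDer}(\sigma)))$. Then $\Phi$ and $\mathrm F_3$ are bijections of $\mathfrak S_n$ onto itself, and for every $\sigma\in\mathfrak S_n$: $$(\mathrm{fix},\mathrm{RIZE},\mathrm{Der})\,\sigma=(\mathrm{fix},\mathrm{RISE},\mathrm{Der})\,\Phi(\sigma);$$ $$(\mathrm{fix},\mathrm{maz},\mathrm{Der})\,\sigma=(\mathrm{fix},\mathrm{maf},\mathrm{Der})\,\mathrm F_3(\sigma);$$ $$(\mathrm{fix},\mathrm{maj},\mathrm{Der})\,\sigma=(\mathrm{fix},\mathrm{maf},\mathrm{Der})\,\mathrm F_3\circ\Phi^{ -1}(\sigma).$$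
   Context: Words have nonnegative integer letters. For $w=x_1\cdots x_n$: $\mathrm{DES}\,w=\{i:1\le i\le n-1,\ x_i>x_{i+1}\}$, $\mathrm{maj}\,w=\sum_{i\in\mathrm{DES}\,w}i$, $\mathrm{RISE}\,w=\{i:1\le i\le n,\ x_i\le x_{i+1}\}$ with $x_{n+1}=+\infty$; $\mathrm{Zero}\,w=\{i:x_i=0\}$, $\mathrm{zero}\,w=\#\mathrm{Zero}\,w$; $\mathrm{Pos}\,w$ is the subword of positive letters; $\mathrm{mafz}\,w=\sum_{i\in\mathrm{Zero}\,w}i-\sum_{i=1}^{\mathrm{zero}\,w}i+\mathrm{maj}\,\mathrm{Pos}\,w$. $\mathrm{Sh}(0^{n-m}v)$ is the set of words of length $n$ with $n-m$ zeros and positive-letter subword $v$. A derangement of order $m$ is a permutation word $y_1\cdots y_m$ of $1,\dots,m$ with $y_i\neq i$ for all $i$. Permutations are words $\sigma(1)\cdots\sigma(n)$; $\mathrm{RISE}\,\sigma$, $\mathrm{DES}\,\sigma$, $\mathrm{maj}\,\sigma$ are as for words (with $\sigma(n+1)=+\infty$); $\mathrm{fix}\,\sigma$ is the number of fixed points. $\mathrm{ZDer}$: for $\sigma\in\mathfrak S_n$ let $j_1<\cdots<j_m$ be the non-fixed points, $\mathrm{red}$ the increasing bijection of $\{j_1,\dots,j_m\}$ onto $\{1,\dots,m\}$; $\mathrm{ZDer}(\sigma)=x_1\cdots x_n$ with $x_i=0$ if $\sigma(i)=i$, $x_i=\mathrm{red}(\sigma(i))$ otherwise. It is a bijection from $\mathfrak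 S_n$ onto the union of the classes $\mathrm{Sh}(0^{n-m}v)$, $0\le m\le n$, $v$ a derangement of order $m$. $\mathrm{Der}\,\sigma=\mathrm{Pos}\,\mathrm{ZDer}(\sigma)$ (a derangement of order $m$). $\mathrm{RIZE}\,\sigma=\mathrm{RISE}\,\mathrm{ZDer}(\sigma)$, $\mathrm{maz}\,\sigma=\mathrm{maj}\,\mathrm{ZDer}(\sigma)$, $\mathrm{maf}\,\sigma=\mathrm{mafz}\,\mathrm{ZDer}(\sigma)$. The map ${\bf\Phi}$ on $\mathrm{Sh}(0^{n-m}v)$, $v$ a derangement of order $m$: for $w=x_1\cdots x_n$ and a position $k$ with $x_k>0$, $\mathrm{red}(k)$ is the number of positive letters among $x_1,\dots,x_k$; $x_k$ is excedent if $x_k>\mathrm{red}(k)$, subexcedent if $x_k<\mathrm{red}(k)$; non-subexcedent means $0$ or excedent; $x_0=x_{n+1}=+\infty$ are regarded as non-subexcedent. For $1\le l\le n$: if $l>n-m$, $\phi_l(w)=w$; otherwise let $j$ be the position of the $l$-th zero of $w$ from the left. (a) If $x_{j-1},x_{j+1}$ are both non-subexcedent, $\phi_l(w)=w$. (b) If $x_{j-1}$ is non-subexcedent and $x_{j+1}$ subexcedent, or both are subexcedent with $x_{j-1}>x_{j+1}$: with $k$ the greatest integer $\ge j+1$ such that $x_{j+1}<\cdots<x_k<\mathrm{red}(k)$, $\phi_l(w)=x_1\cdots x_{j-1}x_{j+1}\cdots x_k\,0\,x_{k+1}\cdots x_n$. (c) If $x_{j-1}$ is subexcedent and $x_{j+1}$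 non-subexcedent, or both are subexcedent with $x_{j-1}<x_{j+1}$: with $i$ the smallest integer $\le j-1$ such that $\mathrm{red}(i)>x_i>\cdots>x_{j-1}$, $\phi_l(w)=x_1\cdots x_{i-1}\,0\,x_i\cdots x_{j-1}x_{j+1}\cdots x_n$. Then ${\bf\Phi}=\phi_1\circ\phi_2\circ\cdots\circ\phi_n$. The map ${\bf F}_3$ on words, by induction on length $n$: if $n\le1$ or all letters except the last are $0$, ${\bf F}_3(w)=w$. Otherwise write uniquely $w=w'a0^rb$ with $a\ge1$ the rightmost positive letter among the first $n-1$ letters, $r\ge0$, $b\ge0$ the last letter. (1) $a\le b$: ${\bf F}_3(w)={\bf F}_3(w'a0^r)b$. (2) $a>b$, $r\ge1$: writing ${\bf F}_3(w'a0^r)=w''c$ with $c$ a letter, ${\bf F}_3(w)=0w''b$. (3) $a>b$, $r=0$: writing ${\bf F}_3(w'a)=0^{m_1}x_1v_1\cdots0^{m_k}x_kv_k$ ($m_1\ge0$, $m_2,\dots,m_k\ge1$, $x_i$ positive letters, $v_i$ possibly empty words of positive letters), ${\bf F}_3(w)=x_10^{m_1}v_1x_20^{m_2}v_2\cdots x_k0^{m_k}v_k\,b$. -}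

module Defs where

open import Data.Bool using (if_then_else_)
open import Data.List
  using (List; []; _∷_; _∷ʳ_; _++_; map; filter; zip; take; drop; length; foldr;
         reverse; replicate; applyUpTo; head; last)
open import Data.List.Relation.Binary.Permutation.Propositional using (_↭_)
open import Data.List.Relation.Unary.Linked using (Linked; linked?)
open import Data.Maybe as Maybe using (Maybe; just; nothing; fromMaybe)
open import Data.Nat
  using (ℕ; suc; _+_; _∸_; _<_; _>_; _≤_; _≟_; _<?_; _>?_; _≤?_; zero)
open import Data.Nat.ListAction using (sum)
open import Data.Nat.Properties using (<-cmp)
open import Data.Product using (Σ-syntax; _×_; _,_; proj₁; map₂)
open import Function using (_∘_)
open import Function.Bundles using (Inverse)
open import Level using (0ℓ)
open import Relation.Binary.Bundles using (Setoid)
open import Relation.Binary.Definitions using (tri<; tri≈; tri>)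
open import Relation.Binary.PropositionalEquality using (setoid)
import Relation.Binary.Construct.On as On
open import Relation.Nullary using (Dec; yes; no; does; ¬?; _×-dec_)

infixl 9 _!_

-- Words x₁⋯xₙ.  Positions are 1-based throughout, and sets of positions are
-- represented by their strictly increasing lists of elements, so that equality
-- of sets of positions is equality of lists.
Word : Set
Word = List ℕ

[1⋯_] : ℕ → List ℕ
[1⋯ n ] = applyUpTo suc n

-- w ! i = xᵢ for 1 ≤ i ≤ n, and 0 at every other i.
_!_ : Word → ℕ → ℕ
[]      ! _           = 0
(x ∷ w) ! 0           = 0
(x ∷ w) ! 1           = x
(x ∷ w) ! suc (suc i) = w ! suc i

-- w [ a ⋯ b ] = xₐ xₐ₊₁ ⋯ x_b for a ≥ 1 (empty if b < a).
_[_⋯_] : Word → ℕ → ℕ → Word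
w [ a ⋯ b ] = take (suc b ∸ a) (drop (a ∸ 1) w)

-- The pairs (i , xᵢ), 1 ≤ i ≤ n.
enum : Word → List (ℕ × ℕ)
enum w = zip [1⋯ length w ] w

------------------------------------------------------------------------
-- Statistics on words

-- The first argument is the position of the first letter of the word.
DES-from : ℕ → Word → List ℕ
DES-from i []          = []
DES-from i (x ∷ [])    = []
DES-from i (x ∷ y ∷ w) =
  if does (y <? x) then i ∷ DES-from (suc i) (y ∷ w) else DES-from (suc i) (y ∷ w)

-- The last position is always a rise, since xₙ₊₁ = +∞.
RISE-from : ℕ → Word → List ℕ
RISE-from i []          = []
RISE-from i (x ∷ [])    = i ∷ []
RISE-from i (x ∷ y ∷ w) =
  if does (x ≤? y) then i ∷ RISE-from (suc i) (y ∷ w) else RISE-from (suc i) (y ∷ w)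

DES RISE : Word → List ℕ
DES  = DES-from 1
RISE = RISE-from 1

maj : Word → ℕ
maj = sum ∘ DES

Zero : Word → List ℕ
Zero w = map proj₁ (filter (λ (_ , x) → x ≟ 0) (enum w))

zero# : Word → ℕ
zero# = length ∘ Zero

Pos : Word → Word
Pos = filter (0 <?_)

-- The subtraction never truncates: the elements of Zero w are distinct
-- positive integers, zero# w in number.
mafz : Word → ℕ
mafz w = (sum (Zero w) ∸ sum [1⋯ zero# w ]) + maj (Pos w)

------------------------------------------------------------------------
-- Permutations as words σ(1)⋯σ(n)

Perm : ℕ → Set
Perm n = Σ[ w ∈ Word ] w ↭ [1⋯ n ]

word : ∀ {n} → Perm n → Word
word = proj₁

-- Two permutations are equal when their words are.
𝔖 : ℕ → Setoid 0ℓ 0ℓ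
𝔖 n = On.setoid (setoid Word) (word {n})

fix : Word → ℕ
fix σ = length (filter (λ (i , x) → x ≟ i) (enum σ))

-- The non-fixed points j₁ < ⋯ < jₘ.
nonFixed : Word → List ℕ
nonFixed σ = map proj₁ (filter (λ (i , x) → ¬? (x ≟ i)) (enum σ))

-- The number of elements of js that are ≤ k.  On the elements of js this is
-- the increasing bijection onto {1,…,m}.
rank : List ℕ → ℕ → ℕ
rank js k = length (filter (_≤? k) js)

ZDer : Word → Word
ZDer σ = map (λ (i , x) → if does (x ≟ i) then 0 else rank (nonFixed σ) x) (enum σ)

-- The positions j₁ < ⋯ < jₘ of the positive letters of w.
nonZero : Word → List ℕ
nonZero w = map proj₁ (filter (λ (_ , x) → 0 <? x) (enum w))

-- If w = ZDer σ, then σ(i) = i where xᵢ = 0, and σ(i) is the xᵢ-th element of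
-- {j₁,…,jₘ} where xᵢ > 0.  On words that are not of the form ZDer σ the value
-- is meaningless.
ZDer⁻¹ : Word → Word
ZDer⁻¹ w = map (λ (i , x) → if does (x ≟ 0) then i else nonZero w ! x) (enum w)

Der : Word → Word
Der = Pos ∘ ZDer

RIZE : Word → List ℕ
RIZE = RISE ∘ ZDer

maz maf : Word → ℕ
maz = maj ∘ ZDer
maf = mafz ∘ ZDer

------------------------------------------------------------------------
-- The transformation 𝚽

red : Word → ℕ → ℕ
red w k = length (Pos (w [ 1 ⋯ k ]))

-- The positions 0 and n + 1, where the letter is +∞ by convention, are not
-- subexcedent, because _!_ returns 0 there.  When Pos w is a derangement, the
-- positive letters that are not subexcedent are exactly the excedent ones.
Subexcedent : Word → ℕ → Set
Subexcedent w k = 0 < w ! k × w ! k < red w k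

subexcedent? : ∀ w k → Dec (Subexcedent w k)
subexcedent? w k = (0 <? w ! k) ×-dec (w ! k <? red w k)

-- The greatest k ≥ j + 1 such that xⱼ₊₁ < ⋯ < xₖ < red(k).  The default value
-- is not reached when xⱼ₊₁ is subexcedent, as k = j + 1 then qualifies.
rightEnd : Word → ℕ → ℕ
rightEnd w j = fromMaybe 0 (last (filter good? [1⋯ length w ]))
  where
  good? : ∀ k → Dec (suc j ≤ k × Linked _<_ (w [ suc j ⋯ k ]) × w ! k < red w k)
  good? k = (suc j ≤? k) ×-dec linked? _<?_ (w [ suc j ⋯ k ]) ×-dec (w ! k <? red w k)

-- The smallest i ≤ j - 1 such that red(i) > xᵢ > ⋯ > xⱼ₋₁; likewise, i = j - 1
-- qualifies when xⱼ₋₁ is subexcedent.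
leftEnd : Word → ℕ → ℕ
leftEnd w j = fromMaybe 0 (head (filter good? [1⋯ length w ]))
  where
  good? : ∀ i → Dec (i ≤ j ∸ 1 × Linked _>_ (w [ i ⋯ j ∸ 1 ]) × red w i > w ! i)
  good? i = (i ≤? j ∸ 1) ×-dec linked? _>?_ (w [ i ⋯ j ∸ 1 ]) ×-dec (red w i >? w ! i)

moveRight moveLeft : Word → ℕ → Word
moveRight w j =
  let k = rightEnd w j in
  w [ 1 ⋯ j ∸ 1 ] ++ w [ suc j ⋯ k ] ++ 0 ∷ w [ suc k ⋯ length w ]
moveLeft w j =
  let i = leftEnd w j in
  w [ 1 ⋯ i ∸ 1 ] ++ 0 ∷ w [ i ⋯ j ∸ 1 ] ++ w [ suc j ⋯ length w ]

-- The action on the zero at position j.  Two equal letters xⱼ₋₁ = xⱼ₊₁ cannot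
-- occur in the tri≈ case when Pos w is a permutation.
moveZero : ℕ → Word → Word
moveZero j w with subexcedent? w (j ∸ 1) | subexcedent? w (suc j)
... | no  _ | no  _ = w
... | no  _ | yes _ = moveRight w j
... | yes _ | no  _ = moveLeft w j
... | yes _ | yes _ with <-cmp (w ! (j ∸ 1)) (w ! suc j)
...   | tri< _ _ _ = moveLeft w j
...   | tri≈ _ _ _ = w
...   | tri> _ _ _ = moveRight w j

φ : ℕ → Word → Word
φ l w = if does (l ≤? zero# w) then moveZero (Zero w ! l) w else w

-- φ₁ ∘ φ₂ ∘ ⋯ ∘ φₙ
𝚽 : Word → Word
𝚽 w = foldr φ w [1⋯ length w ]

------------------------------------------------------------------------
-- The transformation 𝐅₃

-- For the reversal of a word w′a0ʳ with a ≥ 1, the pair (a , r); nothing for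
-- the reversal of a word of zeros.
lastPositive : Word → Maybe (ℕ × ℕ)
lastPositive []          = nothing
lastPositive (0 ∷ u)     = Maybe.map (map₂ suc) (lastPositive u)
lastPositive (suc a ∷ u) = just (suc a , 0)

-- γ 0 sends 0^m₁ x₁ v₁ ⋯ 0^mₖ xₖ vₖ to x₁ 0^m₁ v₁ ⋯ xₖ 0^mₖ vₖ; the first
-- argument counts the zeros read since the last positive letter.  Only applied
-- to words ending in a positive letter.
γ : ℕ → Word → Word
γ m []          = replicate m 0
γ m (0 ∷ w)     = γ (suc m) w
γ m (suc x ∷ w) = suc x ∷ replicate m 0 ++ γ 0 w

-- 𝐅₃ (ub) computed from the shape of u, u itself, 𝐅₃ u and b.
append : Maybe (ℕ × ℕ) → (u 𝐅₃u : Word) → ℕ → Word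
append nothing        u 𝐅₃u b = u ∷ʳ b
append (just (a , r)) u 𝐅₃u b with a ≤? b | r
... | yes _ | _     = 𝐅₃u ∷ʳ b
... | no  _ | suc _ = 0 ∷ 𝐅₃u [ 1 ⋯ length 𝐅₃u ∸ 1 ] ∷ʳ b
... | no  _ | zero  = γ 0 𝐅₃u ∷ʳ b

-- Recursion on the reversed word, since 𝐅₃ peels off last letters.
𝐅₃-rev : Word → Word
𝐅₃-rev []      = []
𝐅₃-rev (b ∷ u) = append (lastPositive u) (reverse u) (𝐅₃-rev u) b

𝐅₃ : Word → Word
𝐅₃ = 𝐅₃-rev ∘ reverse

------------------------------------------------------------------------
-- The transformations of permutations

Φ F₃ : Word → Word
Φ  = ZDer⁻¹ ∘ 𝚽 ∘ ZDer
F₃ = ZDer⁻¹ ∘ 𝐅₃ ∘ ZDer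

-- to , from : Inverse (𝔖 n) (𝔖 n) → Perm n → Perm n are a bijection of the
-- symmetric group onto itself and the inverse bijection.
open Inverse public using (to; from)

{-# OPTIONS --safe #-}

-- Only length and positive subword matter for lying in the image of ZDer, and
-- both maps preserve them, so it suffices that 𝚽 and 𝐅₃ are injective on the
-- image: an injective self-map of a finite set is a bijection.
--
-- For 𝐅₃, write mafz w = inv₀ w + maj (Pos w), where inv₀ counts the pairs of a
-- positive letter followed by a zero.  Appending b to a word with last positive
-- letter a and p positive letters increases mafz by p if a > b and by 0
-- otherwise.  Rotating a final zero to the front lowers inv₀ by p, and γ
-- raises it by the number of zeros; this balances the increase of maj in
-- each of the three cases.  Whether the result, stripped of its last letter,
-- starts with a zero tells the two cases a > b apart.
--
-- For 𝚽, compare letters by the order of w at the zeros that are still to be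
-- moved, and by the order of ZDer⁻¹ w, where a fixed point lies between the
-- subexcedent and the excedent letters, at those already moved.  No φₗ changes
-- the rises and descents in this hybrid order.  Moreover φₗ is injective: the
-- neighbours of the moved zero reveal whether it came from the left (it follows
-- a subexcedent letter and ends an increasing run), from the right, or stayed.

module Submission where

open import Defs
open import Data.Bool using (Bool; true; false; if_then_else_; not)
open import Data.Empty using (⊥; ⊥-elim)
open import Data.Fin as Fin using (Fin; toℕ; fromℕ<; funToFin; finToFun)
import Data.Fin.Properties as Fin
open import Data.List
  using (List; []; _∷_; _∷ʳ_; [_]; _++_; map; filter; zip; take; drop; length; foldr; reverse;
         replicate; applyUpTo; head; last; initLast; _∷ʳ′_)
open import Data.List.Membership.Propositional using (_∈_)
open import Data.List.Membership.Propositional.Properties using (∈-map⁺; ∈-filter⁺)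
open import Data.List.Properties hiding (sum-++)
open import Data.List.Relation.Binary.Permutation.Propositional using (_↭_; prep; ↭-refl; ↭-sym; ↭-trans; ↭-reflexive; ↭⇒↭ₛ)
open import Data.List.Relation.Binary.Permutation.Propositional.Properties
  using (shift; ++⁺ˡ; drop-∷; ↭-length; All-resp-↭; ∈-resp-↭)
  renaming (map⁺ to ↭-map⁺)
import Data.List.Relation.Binary.Permutation.Setoid.Properties as Permutationₛ
open import Data.List.Relation.Unary.All as All using (All; []; _∷_)
import Data.List.Relation.Unary.All.Properties as All
open import Data.List.Relation.Unary.AllPairs as AllPairs using (AllPairs; []; _∷_)
import Data.List.Relation.Unary.AllPairs.Properties as AllPairs
open import Data.List.Relation.Unary.Any as Any using (here; there)
open import Data.List.Relation.Unary.Linked as Linked using (Linked; []; [-]; _∷_; linked?)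
import Data.List.Relation.Unary.Linked.Properties as Linked
open import Data.Maybe as Maybe using (Maybe; just; nothing; fromMaybe)
open import Data.Nat hiding (_!; nonZero)
open import Data.Nat.ListAction using (sum)
open import Data.Nat.ListAction.Properties using (sum-++)
open import Data.Nat.Properties
open import Data.Nat.Solver using (module +-*-Solver)
open import Data.Product using (Σ-syntax; ∃-syntax; _×_; _,_; proj₁; proj₂)
open import Data.Sum using (_⊎_; inj₁; inj₂)
open import Data.Unit using (⊤; tt)
open import Function using (_∘_; id)
open import Function.Bundles using (Inverse)
open import Level using (Level)
open import Relation.Binary.Definitions using (tri<; tri≈; tri>)
open import Relation.Binary.PropositionalEquality hiding ([_])
open import Relation.Nullary
open import Relation.Nullary.Decidable using (dec-true; dec-false)
open import Relation.Unary using (Pred; Decidable)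

-- Both maps preserve the positive subword and the length. This settles `Der`, and then `fix`, since
-- the number of fixed points is `n` minus the length of `Der`. The sequence of rises and descents
-- is transported as a whole by `Φ`, so the same equality yields `RIZE` against `RISE` and `maz`
-- against `maj`; the third identity is then the second one at the preimage of `σ` under `Φ`.
--
-- The obstacle for `𝚽` is that its definition speaks of positions and tests only the extreme letter
-- of a run. The relation `Move` describes the same step locally, letter by letter. Invariance and
-- injectivity are proved for `Move`, and the arithmetic of positions serves only to show that
-- `moveZero` performs a `Move`. As the zeros are treated from the right, a zero being moved has
-- only unmoved zeros on its left and only moved ones on its right; both facts are built into
-- `Move`.

private variable
  a b p q ℓ : Level
  A : Set a
  B : Set b

-- Filters, rearrangements and zips of lists

module _ {P : Pred B p} (P? : Decidable P) (f : A → B) where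

  filter-map : ∀ xs → filter P? (map f xs) ≡ map f (filter (P? ∘ f) xs)
  filter-map []       = refl
  filter-map (x ∷ xs) with does (P? (f x))
  ... | true  = cong (f x ∷_) (filter-map xs)
  ... | false = filter-map xs

module _ {P : Pred A p} {Q : Pred A q} (P? : Decidable P) (Q? : Decidable Q) where

  filter-cong-local : ∀ {xs} → All (λ x → does (P? x) ≡ does (Q? x)) xs →
                      filter P? xs ≡ filter Q? xs
  filter-cong-local []               = refl
  filter-cong-local {x ∷ xs} (e ∷ es) with does (P? x) | does (Q? x) | e
  ... | true  | .true  | refl = cong (x ∷_) (filter-cong-local es)
  ... | false | .false | refl = filter-cong-local es

module _ {P : Pred A p} (P? : Decidable P) where

  filter-↭-split : ∀ xs → filter P? xs ++ filter (¬? ∘ P?) xs ↭ xs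
  filter-↭-split []       = ↭-refl
  filter-↭-split (x ∷ xs) with does (P? x)
  ... | true  = prep x (filter-↭-split xs)
  ... | false = ↭-trans (shift x (filter P? xs) _) (prep x (filter-↭-split xs))

++-cancelˡ-↭ : ∀ (xs : List A) {ys zs} → xs ++ ys ↭ xs ++ zs → ys ↭ zs
++-cancelˡ-↭ []       h = h
++-cancelˡ-↭ (x ∷ xs) h = ++-cancelˡ-↭ xs (drop-∷ h)

zip-map-map : ∀ {C : Set b} (f : C → A) (g : C → B) xs →
              zip (map f xs) (map g xs) ≡ map (λ x → f x , g x) xs
zip-map-map f g []       = refl
zip-map-map f g (x ∷ xs) = cong (_ ∷_) (zip-map-map f g xs)

-- Enumeration of letters with their positions

enumFrom : ℕ → Word → List (ℕ × ℕ)
enumFrom i []      = []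
enumFrom i (x ∷ w) = (i , x) ∷ enumFrom (suc i) w

zip-applyUpTo : ∀ (f : ℕ → ℕ) i → (∀ k → f k ≡ i + k) →
                ∀ w → zip (applyUpTo f (length w)) w ≡ enumFrom i w
zip-applyUpTo f i h []      = refl
zip-applyUpTo f i h (x ∷ w) = cong₂ _∷_ (cong (_, x) (trans (h 0) (+-identityʳ i)))
  (zip-applyUpTo (f ∘ suc) (suc i) (λ k → trans (h (suc k)) (+-suc i k)) w)

enum≡enumFrom : ∀ w → enum w ≡ enumFrom 1 w
enum≡enumFrom = zip-applyUpTo suc 1 (λ _ → refl)

proj₂-enumFrom : ∀ i w → map proj₂ (enumFrom i w) ≡ w
proj₂-enumFrom i []      = refl
proj₂-enumFrom i (x ∷ w) = cong (x ∷_) (proj₂-enumFrom (suc i) w)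

proj₂-enum : ∀ w → map proj₂ (enum w) ≡ w
proj₂-enum w rewrite enum≡enumFrom w = proj₂-enumFrom 1 w

proj₁-zip : ∀ (xs : List A) (ys : List B) → length xs ≡ length ys → map proj₁ (zip xs ys) ≡ xs
proj₁-zip []       ys       e = refl
proj₁-zip (x ∷ xs) (y ∷ ys) e = cong (x ∷_) (proj₁-zip xs ys (suc-injective e))

proj₁-enum : ∀ w → map proj₁ (enum w) ≡ [1⋯ length w ]
proj₁-enum w = proj₁-zip _ w (length-applyUpTo suc (length w))

enumFrom-map : ∀ (g : ℕ × ℕ → ℕ) i w →
  enumFrom i (map g (enumFrom i w)) ≡ map (λ p → proj₁ p , g p) (enumFrom i w)
enumFrom-map g i []      = refl
enumFrom-map g i (x ∷ w) = cong (_ ∷_) (enumFrom-map g (suc i) w)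

enum-map : ∀ (g : ℕ × ℕ → ℕ) w →
  enum (map g (enum w)) ≡ map (λ p → proj₁ p , g p) (enum w)
enum-map g w rewrite enum≡enumFrom (map g (enum w)) | enum≡enumFrom w = enumFrom-map g 1 w

-- Rank and selection in strictly increasing lists

Sorted : List ℕ → Set
Sorted = AllPairs _<_

sorted-[1⋯] : ∀ n → Sorted [1⋯ n ]
sorted-[1⋯] n = AllPairs.applyUpTo⁺₁ suc n (λ i<j _ → s<s i<j)

sorted-filter-enum : ∀ {P : Pred (ℕ × ℕ) p} (P? : Decidable P) w → Sorted (map proj₁ (filter P? (enum w)))
sorted-filter-enum P? w = AllPairs.map⁺ (AllPairs.filter⁺ P? (AllPairs.map⁻ sorted))
  where
  sorted : Sorted (map proj₁ (enum w))
  sorted rewrite proj₁-enum w = sorted-[1⋯] (length w)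

rank-head : ∀ {j js} → All (j <_) js → rank (j ∷ js) j ≡ 1
rank-head {j} {js} j<js = begin
  length (filter (_≤? j) (j ∷ js)) ≡⟨ cong length (filter-accept (_≤? j) ≤-refl) ⟩
  suc (length (filter (_≤? j) js)) ≡⟨ cong (suc ∘ length) (filter-none (_≤? j) (All.map <⇒≱ j<js)) ⟩
  1 ∎
  where open ≡-Reasoning

rank-tail : ∀ {j x} js → j < x → rank (j ∷ js) x ≡ suc (rank js x)
rank-tail {j} {x} js j<x = cong length (filter-accept (_≤? x) {xs = js} (<⇒≤ j<x))

rank-positive : ∀ {x js} → x ∈ js → 0 < rank js x
rank-positive {x} x∈ = filter-some (_≤? x) (Any.map (λ e → ≤-reflexive (sym e)) x∈)

!-tail : ∀ j js {t} → 0 < t → (j ∷ js) ! suc t ≡ js ! t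
!-tail j js {suc t} _ = refl

!-rank : ∀ {js x} → Sorted js → x ∈ js → js ! rank js x ≡ x
!-rank {j ∷ js} (j<js ∷ s) (here refl) rewrite rank-head j<js = refl
!-rank {j ∷ js} {x} (j<js ∷ s) (there x∈)
  rewrite rank-tail js (All.lookup j<js x∈) = trans (!-tail j js (rank-positive x∈)) (!-rank s x∈)

!-∈ : ∀ {js t} → 0 < t → t ≤ length js → js ! t ∈ js
!-∈ {j ∷ js} {1} _ _ = here refl
!-∈ {j ∷ js} {suc (suc t)} _ (s≤s t≤) = there (!-∈ z<s t≤)

rank-! : ∀ {js t} → Sorted js → 0 < t → t ≤ length js → rank js (js ! t) ≡ t
rank-! {j ∷ js} {1} (j<js ∷ s) _ _ = rank-head j<js
rank-! {j ∷ js} {suc (suc t)} (j<js ∷ s) _ (s≤s t≤) =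
  trans (rank-tail js (All.lookup j<js (!-∈ {js} z<s t≤))) (cong suc (rank-! s z<s t≤))

map-! : ∀ js → map (js !_) [1⋯ length js ] ≡ js
map-! js = trans (map-applyUpTo suc (js !_) (length js)) (go js)
  where
  go : ∀ js → applyUpTo (λ k → js ! suc k) (length js) ≡ js
  go []       = refl
  go (j ∷ js) = cong (j ∷_) (go js)

[1⋯]-bounds : ∀ n → All (λ t → 0 < t × t ≤ n) [1⋯ n ]
[1⋯]-bounds n = All.applyUpTo⁺₁ suc n (λ i<n → z<s , i<n)

map-rank : ∀ {js} → Sorted js → map (rank js) js ≡ [1⋯ length js ]
map-rank {js} s = begin
  map (rank js) js                            ≡⟨ cong (map (rank js)) (map-! js) ⟨
  map (rank js) (map (js !_) [1⋯ length js ]) ≡⟨ map-∘ _ ⟨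
  map (rank js ∘ (js !_)) [1⋯ length js ]     ≡⟨ map-id-local (All.map (λ (0<t , t≤) → rank-! s 0<t t≤) ([1⋯]-bounds _)) ⟩
  [1⋯ length js ]                             ∎
  where open ≡-Reasoning

-- The image of ZDer

record Derangement (v : Word) : Set where
  constructor derangement
  field
    perm : v ↭ [1⋯ length v ]
    free : All (λ (i , x) → x ≢ i) (enum v)

record DerWord (n : ℕ) (w : Word) : Set where
  constructor derWord
  field
    len : length w ≡ n
    der : Derangement (Pos w)

isFixed? : ∀ (p : ℕ × ℕ) → Dec (proj₂ p ≡ proj₁ p)
isFixed? (i , x) = x ≟ i

positive? : ∀ (p : ℕ × ℕ) → Dec (0 < proj₂ p)
positive? (_ , x) = 0 <? x

Pos-enum : ∀ w → Pos w ≡ map proj₂ (filter positive? (enum w))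
Pos-enum w = trans (cong Pos (sym (proj₂-enum w))) (filter-map (0 <?_) proj₂ (enum w))

length-perm : ∀ {n} {v : Word} → v ↭ [1⋯ n ] → length v ≡ n
length-perm {n} h = trans (↭-length h) (length-applyUpTo suc n)

-- The word `ZDer σ` of a permutation `σ`

module FromPerm {n} {σ : Word} (σ↭ : σ ↭ [1⋯ n ]) where

  js : List ℕ
  js = nonFixed σ

  moved : List (ℕ × ℕ)
  moved = filter (¬? ∘ isFixed?) (enum σ)

  js-sorted : Sorted js
  js-sorted = sorted-filter-enum _ σ

  -- Positions and letters of `σ` are rearrangements of the same list, and they agree at the fixed
  -- points, which can therefore be cancelled.
  values : map proj₂ moved ↭ js
  values = ++-cancelˡ-↭ (map proj₁ fixed)
    (↭-trans (↭-reflexive eq₁)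
    (↭-trans (↭-map⁺ proj₂ split)
    (↭-trans (↭-reflexive (proj₂-enum σ))
    (↭-trans σ↭
    (↭-trans (↭-reflexive eq₂)
    (↭-trans (↭-map⁺ proj₁ (↭-sym split))
    (↭-reflexive (map-++ proj₁ fixed moved))))))))
    where
    fixed = filter isFixed? (enum σ)
    split : fixed ++ moved ↭ enum σ
    split = filter-↭-split isFixed? (enum σ)
    eq₁ : map proj₁ fixed ++ map proj₂ moved ≡ map proj₂ (fixed ++ moved)
    eq₁ = trans (cong (_++ map proj₂ moved) (map-cong-local (All.map sym (All.all-filter isFixed? (enum σ)))))
                (sym (map-++ proj₂ fixed moved))
    eq₂ : [1⋯ n ] ≡ map proj₁ (enum σ)
    eq₂ = trans (cong [1⋯_] (sym (length-perm σ↭))) (sym (proj₁-enum σ))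

  moved-∈ : All (λ (i , x) → i ∈ js × x ∈ js) moved
  moved-∈ = All.tabulate λ p∈ → ∈-map⁺ proj₁ p∈ , ∈-resp-↭ values (∈-map⁺ proj₂ p∈)

  letter : ℕ × ℕ → ℕ
  letter (i , x) = if does (x ≟ i) then 0 else rank js x

  data Kind : ℕ × ℕ → Set where
    isFixed : ∀ {i} → letter (i , i) ≡ 0 → Kind (i , i)
    isMoved : ∀ {i x} → x ≢ i → letter (i , x) ≡ rank js x → i ∈ js → x ∈ js → Kind (i , x)

  kinds : All Kind (enum σ)
  kinds = All.tabulate kind
    where
    kind : ∀ {p} → p ∈ enum σ → Kind p
    kind {i , x} p∈ with x ≟ i in eq
    ... | yes refl = isFixed (cong (λ d → if does d then 0 else rank js x) eq)
    ... | no  x≢i  = let i∈ , x∈ = All.lookup moved-∈ (∈-filter⁺ (¬? ∘ isFixed?) p∈ x≢i) in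
                     isMoved x≢i (cong (λ d → if does d then 0 else rank js x) eq) i∈ x∈

  positive≡moved : All (λ p → does (0 <? letter p) ≡ does (¬? (isFixed? p))) (enum σ)
  positive≡moved = All.map f kinds
    where
    f : ∀ {p} → Kind p → does (0 <? letter p) ≡ does (¬? (isFixed? p))
    f {i , _} (isFixed e) rewrite e | dec-true (i ≟ i) refl = refl
    f {i , x} (isMoved x≢i e _ x∈) rewrite e | dec-false (x ≟ i) x≢i =
      dec-true (0 <? rank js x) (rank-positive x∈)

  Pos-ZDer : Pos (ZDer σ) ≡ map (rank js ∘ proj₂) moved
  Pos-ZDer = begin
    Pos (map letter (enum σ))                            ≡⟨ filter-map (0 <?_) letter (enum σ) ⟩
    map letter (filter ((0 <?_) ∘ letter) (enum σ))      ≡⟨ cong (map letter) (filter-cong-local _ _ positive≡moved) ⟩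
    map letter moved                                     ≡⟨ map-cong-local (All.map f (All.all-filter (¬? ∘ isFixed?) (enum σ))) ⟩
    map (rank js ∘ proj₂) moved                          ∎
    where
    open ≡-Reasoning
    f : ∀ {p} → proj₂ p ≢ proj₁ p → letter p ≡ rank js (proj₂ p)
    f {i , x} x≢i rewrite dec-false (x ≟ i) x≢i = refl

  nonZero-ZDer : nonZero (ZDer σ) ≡ js
  nonZero-ZDer = begin
    map proj₁ (filter positive? (enum (map letter (enum σ))))
      ≡⟨ cong (map proj₁ ∘ filter positive?) (enum-map letter σ) ⟩
    map proj₁ (filter positive? (map (λ p → proj₁ p , letter p) (enum σ)))
      ≡⟨ cong (map proj₁) (filter-map positive? _ (enum σ)) ⟩
    map proj₁ (map (λ p → proj₁ p , letter p) (filter ((0 <?_) ∘ letter) (enum σ)))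
      ≡⟨ map-∘ _ ⟨
    map proj₁ (filter ((0 <?_) ∘ letter) (enum σ))
      ≡⟨ cong (map proj₁) (filter-cong-local _ _ positive≡moved) ⟩
    js ∎
    where open ≡-Reasoning

  ZDer⁻¹-ZDer : ZDer⁻¹ (ZDer σ) ≡ σ
  ZDer⁻¹-ZDer = begin
    map (λ (i , x) → if does (x ≟ 0) then i else nonZero (ZDer σ) ! x) (enum (ZDer σ))
      ≡⟨ cong (λ js → map (λ (i , x) → if does (x ≟ 0) then i else js ! x) (enum (ZDer σ))) nonZero-ZDer ⟩
    map (λ (i , x) → if does (x ≟ 0) then i else js ! x) (enum (ZDer σ))
      ≡⟨ cong (map _) (enum-map letter σ) ⟩
    map (λ (i , x) → if does (x ≟ 0) then i else js ! x) (map (λ p → proj₁ p , letter p) (enum σ))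
      ≡⟨ map-∘ _ ⟨
    map (λ p → if does (letter p ≟ 0) then proj₁ p else js ! letter p) (enum σ)
      ≡⟨ map-cong-local (All.map f kinds) ⟩
    map proj₂ (enum σ)
      ≡⟨ proj₂-enum σ ⟩
    σ ∎
    where
    open ≡-Reasoning
    f : ∀ {p} → Kind p → (if does (letter p ≟ 0) then proj₁ p else js ! letter p) ≡ proj₂ p
    f (isFixed e) rewrite e = refl
    f {i , x} (isMoved _ e _ x∈) rewrite e | dec-false (rank js x ≟ 0) (≢-sym (<⇒≢ (rank-positive x∈))) =
      !-rank js-sorted x∈

  length-Der : length (Pos (ZDer σ)) ≡ length js
  length-Der = trans (cong length Pos-ZDer) (trans (length-map _ moved) (sym (length-map proj₁ moved)))

  enum-Der : enum (Pos (ZDer σ)) ≡ map (λ (i , x) → rank js i , rank js x) moved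
  enum-Der = begin
    zip [1⋯ length (Pos (ZDer σ)) ] (Pos (ZDer σ))
      ≡⟨ cong₂ zip (trans (cong [1⋯_] length-Der) (trans (sym (map-rank js-sorted)) (sym (map-∘ moved)))) Pos-ZDer ⟩
    zip (map (rank js ∘ proj₁) moved) (map (rank js ∘ proj₂) moved)
      ≡⟨ zip-map-map _ _ moved ⟩
    map (λ (i , x) → rank js i , rank js x) moved ∎
    where open ≡-Reasoning

  ZDer-DerWord : DerWord n (ZDer σ)
  ZDer-DerWord = derWord
    (trans (length-map letter (enum σ)) (trans (sym (length-map proj₂ (enum σ))) (trans (cong length (proj₂-enum σ)) (length-perm σ↭))))
    (derangement perm free)
    where
    perm : Pos (ZDer σ) ↭ [1⋯ length (Pos (ZDer σ)) ]
    perm = ↭-trans (↭-reflexive (trans Pos-ZDer (map-∘ moved)))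
             (↭-trans (↭-map⁺ (rank js) values)
               (↭-reflexive (trans (map-rank js-sorted) (cong [1⋯_] (sym length-Der)))))
    free : All (λ (i , x) → x ≢ i) (enum (Pos (ZDer σ)))
    free rewrite enum-Der = All.map⁺ (All.zipWith
      (λ (x≢i , i∈ , x∈) e → x≢i (trans (sym (!-rank js-sorted x∈)) (trans (cong (js !_) e) (!-rank js-sorted i∈))))
      (All.all-filter (¬? ∘ isFixed?) (enum σ) , moved-∈))

  -- Makes `fix` a function of `Der`, so that it need not be followed through either map.
  fix+length-Der : fix σ + length (Der σ) ≡ n
  fix+length-Der = begin
    fix σ + length (Der σ)  ≡⟨ cong (fix σ +_) (trans length-Der (length-map proj₁ moved)) ⟩
    fix σ + length moved ≡⟨ length-++ (filter isFixed? (enum σ)) ⟨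
    length (filter isFixed? (enum σ) ++ moved) ≡⟨ ↭-length (filter-↭-split isFixed? (enum σ)) ⟩
    length (enum σ) ≡⟨ length-map proj₂ (enum σ) ⟨
    length (map proj₂ (enum σ)) ≡⟨ cong length (proj₂-enum σ) ⟩
    length σ ≡⟨ length-perm σ↭ ⟩
    n ∎
    where open ≡-Reasoning

-- The permutation of a word whose positive letters form a derangement

module FromDerWord {n} {w : Word} (w∈ : DerWord n w) where

  open DerWord w∈
  open Derangement der

  js : List ℕ
  js = nonZero w

  js-sorted : Sorted js
  js-sorted = sorted-filter-enum _ w

  pos : List (ℕ × ℕ)
  pos = filter positive? (enum w)

  length-js : length js ≡ length (Pos w)
  length-js = trans (length-map proj₁ pos) (trans (sym (length-map proj₂ pos)) (cong length (sym (Pos-enum w))))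

  value : ℕ × ℕ → ℕ
  value (i , x) = if does (x ≟ 0) then i else js ! x

  map-!-js : map (js !_) [1⋯ length (Pos w) ] ≡ js
  map-!-js = trans (cong (map (js !_) ∘ [1⋯_]) (sym length-js)) (map-! js)

  bounds : All (λ x → 0 < x × x ≤ length js) (Pos w)
  bounds rewrite length-js = All-resp-↭ (↭-sym perm) ([1⋯]-bounds _)

  -- The `t`-th positive letter stands at position `js ! t`. This transfers the absence of fixed
  -- points from reduced positions to actual ones.
  pos≡ : pos ≡ map (λ (t , x) → js ! t , x) (enum (Pos w))
  pos≡ = begin
    pos ≡⟨ map-id pos ⟨
    map (λ p → proj₁ p , proj₂ p) pos ≡⟨ zip-map-map proj₁ proj₂ pos ⟨
    zip js (map proj₂ pos) ≡⟨ cong₂ zip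
         (trans (sym map-!-js) (trans (cong (map (js !_)) (sym (proj₁-enum (Pos w)))) (sym (map-∘ (enum (Pos w))))))
         (trans (sym (Pos-enum w)) (sym (proj₂-enum (Pos w)))) ⟩
    zip (map ((js !_) ∘ proj₁) (enum (Pos w))) (map proj₂ (enum (Pos w))) ≡⟨ zip-map-map _ _ (enum (Pos w)) ⟩
    map (λ (t , x) → js ! t , x) (enum (Pos w)) ∎
    where open ≡-Reasoning

  data Kind : ℕ × ℕ → Set where
    zero     : ∀ {i} → Kind (i , 0)
    positive : ∀ {i x} → js ! suc x ≢ i → suc x ≤ length js → Kind (i , suc x)

  kinds : All Kind (enum w)
  kinds = All.tabulate kind
    where
    injective : ∀ {s t} → 0 < s × s ≤ length js → 0 < t × t ≤ length js → js ! s ≡ js ! t → s ≡ t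
    injective (0<s , s≤) (0<t , t≤) e =
      trans (sym (rank-! js-sorted 0<s s≤)) (trans (cong (rank js) e) (rank-! js-sorted 0<t t≤))
    bounds₁ : All (λ (t , _) → 0 < t × t ≤ length js) (enum (Pos w))
    bounds₁ = All.map⁻ (subst₂ (λ xs m → All (λ t → 0 < t × t ≤ m) xs)
                (sym (proj₁-enum (Pos w))) (sym length-js) ([1⋯]-bounds _))
    bounds₂ : All (λ (_ , x) → 0 < x × x ≤ length js) (enum (Pos w))
    bounds₂ = All.map⁻ (subst (All _) (sym (proj₂-enum (Pos w))) bounds)
    pos-kinds : All (λ (i , x) → js ! x ≢ i × x ≤ length js) pos
    pos-kinds = subst (All _) (sym pos≡) (All.map⁺ (All.zipWith
      (λ (x≢t , bt , bx) → (λ e → x≢t (injective bx bt e)) , proj₂ bx)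
      (free , All.zipWith id (bounds₁ , bounds₂))))
    kind : ∀ {p} → p ∈ enum w → Kind p
    kind {i , zero}  p∈ = zero
    kind {i , suc x} p∈ = let ≢i , ≤m = All.lookup pos-kinds (∈-filter⁺ positive? p∈ z<s) in positive ≢i ≤m

  nonFixed-ZDer⁻¹ : nonFixed (ZDer⁻¹ w) ≡ js
  nonFixed-ZDer⁻¹ = begin
    map proj₁ (filter (¬? ∘ isFixed?) (enum (map value (enum w))))
      ≡⟨ cong (map proj₁ ∘ filter (¬? ∘ isFixed?)) (enum-map value w) ⟩
    map proj₁ (filter (¬? ∘ isFixed?) (map (λ p → proj₁ p , value p) (enum w)))
      ≡⟨ cong (map proj₁) (filter-map (¬? ∘ isFixed?) _ (enum w)) ⟩
    map proj₁ (map (λ p → proj₁ p , value p) (filter (¬? ∘ isFixed? ∘ (λ p → proj₁ p , value p)) (enum w)))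
      ≡⟨ map-∘ _ ⟨
    map proj₁ (filter (¬? ∘ isFixed? ∘ (λ p → proj₁ p , value p)) (enum w))
      ≡⟨ cong (map proj₁) (filter-cong-local _ _ (All.map f kinds)) ⟩
    js ∎
    where
    open ≡-Reasoning
    f : ∀ {p} → Kind p → does (¬? (value p ≟ proj₁ p)) ≡ does (positive? p)
    f {i , _} zero rewrite dec-true (i ≟ i) refl = refl
    f {i , suc x} (positive ≢i _) rewrite dec-false (js ! suc x ≟ i) ≢i = refl

  ZDer-ZDer⁻¹ : ZDer (ZDer⁻¹ w) ≡ w
  ZDer-ZDer⁻¹ = begin
    map (λ (i , x) → if does (x ≟ i) then 0 else rank (nonFixed (ZDer⁻¹ w)) x) (enum (ZDer⁻¹ w))
      ≡⟨ cong (λ js → map (λ (i , x) → if does (x ≟ i) then 0 else rank js x) (enum (ZDer⁻¹ w))) nonFixed-ZDer⁻¹ ⟩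
    map (λ (i , x) → if does (x ≟ i) then 0 else rank js x) (enum (ZDer⁻¹ w))
      ≡⟨ cong (map _) (enum-map value w) ⟩
    map (λ (i , x) → if does (x ≟ i) then 0 else rank js x) (map (λ p → proj₁ p , value p) (enum w))
      ≡⟨ map-∘ _ ⟨
    map (λ p → if does (value p ≟ proj₁ p) then 0 else rank js (value p)) (enum w)
      ≡⟨ map-cong-local (All.map f kinds) ⟩
    map proj₂ (enum w)
      ≡⟨ proj₂-enum w ⟩
    w ∎
    where
    open ≡-Reasoning
    f : ∀ {p} → Kind p → (if does (value p ≟ proj₁ p) then 0 else rank js (value p)) ≡ proj₂ p
    f {i , _} zero rewrite dec-true (i ≟ i) refl = refl
    f {i , suc x} (positive ≢i ≤m) rewrite dec-false (js ! suc x ≟ i) ≢i = rank-! js-sorted z<s ≤m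

  ZDer⁻¹-perm : ZDer⁻¹ w ↭ [1⋯ n ]
  ZDer⁻¹-perm =
    ↭-trans (↭-map⁺ value (↭-sym split))
    (↭-trans (↭-reflexive eq)
    (↭-trans (++⁺ˡ (map proj₁ zeros) (↭-map⁺ (js !_) perm))
    (↭-trans (↭-reflexive (cong (map proj₁ zeros ++_) map-!-js))
    (↭-trans (↭-reflexive (sym (map-++ proj₁ zeros pos)))
    (↭-trans (↭-map⁺ proj₁ split)
    (↭-reflexive (trans (proj₁-enum w) (cong [1⋯_] len))))))))
    where
    zeros = filter (¬? ∘ positive?) (enum w)
    split : zeros ++ pos ↭ enum w
    split = ↭-trans (↭-reflexive (cong (zeros ++_)
                      (filter-cong-local positive? (¬? ∘ ¬? ∘ positive?) {enum w}
                        (All.tabulate λ {p} _ → not-not (does (positive? p))))))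
                    (filter-↭-split (¬? ∘ positive?) (enum w))
      where
      not-not : ∀ b → b ≡ not (not b)
      not-not true  = refl
      not-not false = refl
    on-zero : ∀ {p} → ¬ (0 < proj₂ p) → value p ≡ proj₁ p
    on-zero {i , zero}  _ = refl
    on-zero {i , suc x} h = ⊥-elim (h z<s)
    on-pos : ∀ {p} → 0 < proj₂ p → value p ≡ js ! proj₂ p
    on-pos {i , suc x} _ = refl
    eq : map value (zeros ++ pos) ≡ map proj₁ zeros ++ map (js !_) (Pos w)
    eq = trans (map-++ value zeros pos) (cong₂ _++_
           (map-cong-local (All.map on-zero (All.all-filter (¬? ∘ positive?) (enum w))))
           (trans (map-cong-local (All.map on-pos (All.all-filter positive? (enum w))))
             (trans (map-∘ pos) (cong (map (js !_)) (sym (Pos-enum w))))))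

-- Injective self-maps of the symmetric group

!-≤ : ∀ {n w} → All (_≤ n) w → ∀ k → w ! k ≤ n
!-≤ {w = []}     _        k             = z≤n
!-≤ {w = _ ∷ _}  _        0             = z≤n
!-≤ {w = _ ∷ _}  (x≤ ∷ _) 1             = x≤
!-≤ {w = _ ∷ _}  (_ ∷ w≤) (suc (suc k)) = !-≤ w≤ (suc k)

!-extensional : ∀ {w w′} → length w ≡ length w′ →
                (∀ k → k < length w → w ! suc k ≡ w′ ! suc k) → w ≡ w′
!-extensional {[]}    {[]}     _ _ = refl
!-extensional {x ∷ w} {y ∷ w′} e h =
  cong₂ _∷_ (h 0 z<s) (!-extensional (suc-injective e) (λ k k< → h (suc k) (s<s k<)))

letters-≤ : ∀ {n} (σ : Perm n) → All (_≤ n) (word σ)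
letters-≤ {n} (_ , σ↭) = All-resp-↭ (↭-sym σ↭) (All.map proj₂ ([1⋯]-bounds n))

letters : ∀ {n} → Perm n → Fin n → Fin (suc n)
letters σ i = fromℕ< (s<s (!-≤ (letters-≤ σ) (suc (toℕ i))))

-- A word of length `n` with letters in {0,...,n} is a function between finite sets. The pigeonhole
-- principle only asks for some finite bound, so the crude one serves in place of a count of
-- permutations.
encode : ∀ {n} → Perm n → Fin (suc n ^ n)
encode σ = funToFin (letters σ)

encode-injective : ∀ {n} (σ τ : Perm n) → encode σ ≡ encode τ → word σ ≡ word τ
encode-injective {n} σ τ e = !-extensional (trans |σ| (sym |τ|)) same
  where
  |σ| = length-perm (proj₂ σ)
  |τ| = length-perm (proj₂ τ)
  letters≡ : ∀ i → letters σ i ≡ letters τ i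
  letters≡ i = begin
    letters σ i             ≡⟨ Fin.finToFun-funToFin (letters σ) i ⟨
    finToFun (encode σ) i   ≡⟨ cong (λ c → finToFun c i) e ⟩
    finToFun (encode τ) i   ≡⟨ Fin.finToFun-funToFin (letters τ) i ⟩
    letters τ i             ∎
    where open ≡-Reasoning
  same : ∀ k → k < length (word σ) → word σ ! suc k ≡ word τ ! suc k
  same k k< = begin
    word σ ! suc k         ≡⟨ cong (λ k → word σ ! suc k) k≡ ⟩
    word σ ! suc (toℕ i)   ≡⟨ Fin.toℕ-fromℕ< _ ⟨
    toℕ (letters σ i)      ≡⟨ cong toℕ (letters≡ i) ⟩
    toℕ (letters τ i)      ≡⟨ Fin.toℕ-fromℕ< _ ⟩
    word τ ! suc (toℕ i)   ≡⟨ cong (λ k → word τ ! suc k) k≡ ⟨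
    word τ ! suc k         ∎
    where
    open ≡-Reasoning
    i : Fin n
    i = fromℕ< (subst (k <_) |σ| k<)
    k≡ : k ≡ toℕ i
    k≡ = sym (Fin.toℕ-fromℕ< _)

module SelfMap {n} (f : Perm n → Perm n)
  (f-cong : ∀ σ τ → word σ ≡ word τ → word (f σ) ≡ word (f τ))
  (f-injective : ∀ σ τ → word (f σ) ≡ word (f τ) → word σ ≡ word τ) where

  iter : ℕ → Perm n → Perm n
  iter zero    σ = σ
  iter (suc k) σ = f (iter k σ)

  -- Cancelling `i` applications of `f` turns a repetition among the iterates into a return to `σ`
  -- itself after `j - i` steps; the iterate just before the return is a preimage.
  iter-cancel : ∀ i j → i < j → ∀ σ → word (iter i σ) ≡ word (iter j σ) →
                ∃[ k ] word (f (iter k σ)) ≡ word σ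
  iter-cancel zero    (suc j) _         σ e = j , sym e
  iter-cancel (suc i) (suc j) (s≤s i<j) σ e = iter-cancel i j i<j σ (f-injective _ _ e)

  preimage : ∀ σ → ∃[ k ] word (f (iter k σ)) ≡ word σ
  preimage σ =
    let i , j , i<j , e = Fin.pigeonhole (n<1+n _) (λ k → encode (iter (toℕ k) σ)) in
    iter-cancel (toℕ i) (toℕ j) i<j σ (encode-injective (iter (toℕ i) σ) (iter (toℕ j) σ) e)

  f⁻¹ : Perm n → Perm n
  f⁻¹ σ = iter (proj₁ (preimage σ)) σ

  f-f⁻¹ : ∀ σ → word (f (f⁻¹ σ)) ≡ word σ
  f-f⁻¹ σ = proj₂ (preimage σ)

  inverse : Inverse (𝔖 n) (𝔖 n)
  inverse = record
    { to        = f
    ; from      = f⁻¹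
    ; to-cong   = λ {σ} {τ} → f-cong σ τ
    -- The exponents found for `σ` and `τ` come from separate searches; injectivity of `f` reduces
    -- the claim to the images.
    ; from-cong = λ {σ} {τ} e → f-injective _ _ (trans (f-f⁻¹ σ) (trans e (sym (f-f⁻¹ τ))))
    ; inverse   = (λ {σ} {τ} e → trans (f-cong τ (f⁻¹ σ) e) (f-f⁻¹ σ))
                , (λ {σ} {τ} e → f-injective _ _ (trans (f-f⁻¹ τ) e))
    }

module Conjugate {n} (F : Word → Word)
  (F-DerWord : ∀ {w} → DerWord n w → DerWord n (F w))
  (F-injective : ∀ {w w′} → DerWord n w → DerWord n w′ → F w ≡ F w′ → w ≡ w′) where

  f : Perm n → Perm n
  f (σ , σ↭) = ZDer⁻¹ (F (ZDer σ)) , FromDerWord.ZDer⁻¹-perm (F-DerWord (FromPerm.ZDer-DerWord σ↭))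

  ZDer-f : ∀ σ → ZDer (word (f σ)) ≡ F (ZDer (word σ))
  ZDer-f (σ , σ↭) = FromDerWord.ZDer-ZDer⁻¹ (F-DerWord (FromPerm.ZDer-DerWord σ↭))

  f-injective : ∀ σ τ → word (f σ) ≡ word (f τ) → word σ ≡ word τ
  f-injective σ@(s , s↭) τ@(t , t↭) e = begin
    s                  ≡⟨ FromPerm.ZDer⁻¹-ZDer s↭ ⟨
    ZDer⁻¹ (ZDer s)    ≡⟨ cong ZDer⁻¹ (F-injective (FromPerm.ZDer-DerWord s↭) (FromPerm.ZDer-DerWord t↭)
                           (trans (sym (ZDer-f σ)) (trans (cong ZDer e) (ZDer-f τ)))) ⟩
    ZDer⁻¹ (ZDer t)    ≡⟨ FromPerm.ZDer⁻¹-ZDer t↭ ⟩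
    t                  ∎
    where open ≡-Reasoning

  open SelfMap f (λ _ _ → cong (ZDer⁻¹ ∘ F ∘ ZDer)) f-injective public using (inverse)

-- maj and mafz of a word extended by one letter

-- The increment of maj when the letter b is appended to the reversal of u.
descent : ℕ → Word → ℕ
descent b []        = 0
descent b u@(a ∷ _) = if does (b <? a) then length u else 0

DES-snoc : ∀ i w a b → DES-from i (w ∷ʳ a ∷ʳ b) ≡
           DES-from i (w ∷ʳ a) ++ (if does (b <? a) then [ i + length w ] else [])
DES-snoc i []      a b rewrite +-identityʳ i = refl
DES-snoc i (x ∷ []) a b with does (a <? x) | DES-snoc (suc i) [] a b
... | true  | h rewrite +-suc i 0 = cong (i ∷_) h
... | false | h rewrite +-suc i 0 = h
DES-snoc i (x ∷ y ∷ w) a b with does (y <? x) | DES-snoc (suc i) (y ∷ w) a b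
... | true  | h rewrite +-suc i (suc (length w)) = cong (i ∷_) h
... | false | h rewrite +-suc i (suc (length w)) = h

maj-snoc : ∀ u b → maj (reverse u ∷ʳ b) ≡ maj (reverse u) + descent b u
maj-snoc []      b = refl
maj-snoc (a ∷ u) b = begin
  maj (reverse (a ∷ u) ∷ʳ b)                        ≡⟨ cong (λ v → maj (v ∷ʳ b)) (unfold-reverse a u) ⟩
  maj (reverse u ∷ʳ a ∷ʳ b)                         ≡⟨ cong sum (DES-snoc 1 (reverse u) a b) ⟩
  sum (DES (reverse u ∷ʳ a) ++ D)                   ≡⟨ sum-++ (DES (reverse u ∷ʳ a)) D ⟩
  maj (reverse u ∷ʳ a) + sum D                      ≡⟨ cong₂ _+_ (cong maj (sym (unfold-reverse a u))) sum-D ⟩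
  maj (reverse (a ∷ u)) + descent b (a ∷ u)         ∎
  where
  open ≡-Reasoning
  D = if does (b <? a) then [ 1 + length (reverse u) ] else []
  sum-D : sum D ≡ descent b (a ∷ u)
  sum-D with does (b <? a)
  ... | true  = cong suc (trans (+-identityʳ _) (length-reverse u))
  ... | false = refl

-- The number of pairs formed by a zero and a positive letter to its left,
-- with r positive letters preceding the word.
inv₀ : ℕ → Word → ℕ
inv₀ r []          = 0
inv₀ r (0 ∷ w)     = r + inv₀ r w
inv₀ r (suc x ∷ w) = inv₀ (suc r) w

Zero-from : ℕ → Word → List ℕ
Zero-from i w = map proj₁ (filter (λ (_ , x) → x ≟ 0) (enumFrom i w))

Zero≡ : ∀ w → Zero w ≡ Zero-from 1 w
Zero≡ w = cong (map proj₁ ∘ filter _) (enum≡enumFrom w)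

-- A zero preceded by `c` zeros and `r` positive letters stands at position `c + r + 1`: it
-- contributes `c + 1` to the sum of the first integers and `r` to `inv₀`.
sum-Zero-from : ∀ c r w → sum (Zero-from (suc (c + r)) w) ≡
  sum (applyUpTo (λ k → suc (c + k)) (length (Zero-from (suc (c + r)) w))) + inv₀ r w
sum-Zero-from c r []          = refl
sum-Zero-from c r (suc x ∷ w) rewrite sym (+-suc c r) = sum-Zero-from c (suc r) w
sum-Zero-from c r (0 ∷ w)     = begin
  suc (c + r) + sum (Zero-from (suc (suc c + r)) w)
    ≡⟨ cong (suc (c + r) +_) (sum-Zero-from (suc c) r w) ⟩
  suc (c + r) + (sum (applyUpTo (λ k → suc (suc c + k)) z) + inv₀ r w)
    ≡⟨ cong (λ s → suc (c + r) + (s + inv₀ r w)) sum≡ ⟩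
  suc (c + r) + (sum (applyUpTo (λ k → suc (c + suc k)) z) + inv₀ r w)
    ≡⟨ solve 4 (λ c r s i → con 1 :+ (c :+ r) :+ (s :+ i) := con 1 :+ (c :+ con 0) :+ s :+ (r :+ i)) refl
         c r (sum (applyUpTo (λ k → suc (c + suc k)) z)) (inv₀ r w) ⟩
  (suc (c + 0) + sum (applyUpTo (λ k → suc (c + suc k)) z)) + (r + inv₀ r w) ∎
  where
  open ≡-Reasoning
  open +-*-Solver
  z = length (Zero-from (suc (suc c + r)) w)
  applyUpTo-cong : ∀ {f g : ℕ → ℕ} → (∀ k → f k ≡ g k) → ∀ n → applyUpTo f n ≡ applyUpTo g n
  applyUpTo-cong h zero    = refl
  applyUpTo-cong h (suc n) = cong₂ _∷_ (h 0) (applyUpTo-cong (h ∘ suc) n)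
  sum≡ = cong sum (applyUpTo-cong (λ k → cong suc (sym (+-suc c k))) z)

mafz≡ : ∀ w → mafz w ≡ inv₀ 0 w + maj (Pos w)
mafz≡ w = cong (_+ maj (Pos w)) (begin
  sum (Zero w) ∸ sum [1⋯ zero# w ]
    ≡⟨ cong (λ z → sum z ∸ sum [1⋯ length z ]) (Zero≡ w) ⟩
  sum (Zero-from 1 w) ∸ sum [1⋯ length (Zero-from 1 w) ]
    ≡⟨ cong (_∸ sum [1⋯ length (Zero-from 1 w) ]) (sum-Zero-from 0 0 w) ⟩
  sum [1⋯ length (Zero-from 1 w) ] + inv₀ 0 w ∸ sum [1⋯ length (Zero-from 1 w) ]
    ≡⟨ m+n∸m≡n (sum [1⋯ length (Zero-from 1 w) ]) (inv₀ 0 w) ⟩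
  inv₀ 0 w ∎)
  where open ≡-Reasoning

inv₀-snoc-0 : ∀ r w → inv₀ r (w ∷ʳ 0) ≡ inv₀ r w + (r + length (Pos w))
inv₀-snoc-0 r []          = refl
inv₀-snoc-0 r (0 ∷ w)     = trans (cong (r +_) (inv₀-snoc-0 r w)) (sym (+-assoc r (inv₀ r w) _))
inv₀-snoc-0 r (suc x ∷ w) = trans (inv₀-snoc-0 (suc r) w) (cong (inv₀ (suc r) w +_) (sym (+-suc r _)))

inv₀-snoc-suc : ∀ r w b → inv₀ r (w ∷ʳ suc b) ≡ inv₀ r w
inv₀-snoc-suc r []          b = refl
inv₀-snoc-suc r (0 ∷ w)     b = cong (r +_) (inv₀-snoc-suc r w b)
inv₀-snoc-suc r (suc x ∷ w) b = inv₀-snoc-suc (suc r) w b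

Pos-snoc-0 : ∀ w → Pos (w ∷ʳ 0) ≡ Pos w
Pos-snoc-0 w = trans (filter-++ (0 <?_) w [ 0 ]) (++-identityʳ _)

Pos-snoc-suc : ∀ w b → Pos (w ∷ʳ suc b) ≡ Pos w ∷ʳ suc b
Pos-snoc-suc w b = filter-++ (0 <?_) w [ suc b ]

Pos-cong-snoc : ∀ w w′ b → Pos w ≡ Pos w′ → Pos (w ∷ʳ b) ≡ Pos (w′ ∷ʳ b)
Pos-cong-snoc w w′ b e = trans (filter-++ (0 <?_) w [ b ])
  (trans (cong (_++ Pos [ b ]) e) (sym (filter-++ (0 <?_) w′ [ b ])))

Pos-all-positive : ∀ w → Pos (Pos w) ≡ Pos w
Pos-all-positive = filter-idem (0 <?_)

-- A positive letter b appended to w produces a descent of Pos w; the letter 0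
-- instead forms an inversion with every letter of Pos w.
mafz-snoc : ∀ x v b → Pos x ≡ reverse v → Pos v ≡ v → mafz (x ∷ʳ b) ≡ mafz x + descent b v
mafz-snoc x v 0 e pv = begin
  mafz (x ∷ʳ 0)                                     ≡⟨ mafz≡ (x ∷ʳ 0) ⟩
  inv₀ 0 (x ∷ʳ 0) + maj (Pos (x ∷ʳ 0))              ≡⟨ cong₂ _+_ (inv₀-snoc-0 0 x) (cong maj (Pos-snoc-0 x)) ⟩
  inv₀ 0 x + length (Pos x) + maj (Pos x)           ≡⟨ cong (λ l → inv₀ 0 x + l + maj (Pos x)) length≡ ⟩
  inv₀ 0 x + descent 0 v + maj (Pos x)              ≡⟨ solve 3 (λ i d m → i :+ d :+ m := i :+ m :+ d) refl (inv₀ 0 x) (descent 0 v) (maj (Pos x)) ⟩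
  inv₀ 0 x + maj (Pos x) + descent 0 v              ≡⟨ cong (_+ descent 0 v) (mafz≡ x) ⟨
  mafz x + descent 0 v                              ∎
  where
  open ≡-Reasoning
  open +-*-Solver
  descent-0 : ∀ v → Pos v ≡ v → descent 0 v ≡ length v
  descent-0 []          _ = refl
  descent-0 (suc a ∷ v) _ = refl
  descent-0 (0 ∷ v)     e = contradiction (subst (_≤ length v) (cong length e) (length-filter (0 <?_) v)) 1+n≰n
  length≡ : length (Pos x) ≡ descent 0 v
  length≡ = trans (cong length e) (trans (length-reverse v) (sym (descent-0 v pv)))
mafz-snoc x v (suc b) e pv = begin
  mafz (x ∷ʳ suc b)                                 ≡⟨ mafz≡ (x ∷ʳ suc b) ⟩
  inv₀ 0 (x ∷ʳ suc b) + maj (Pos (x ∷ʳ suc b))      ≡⟨ cong₂ _+_ (inv₀-snoc-suc 0 x b) (cong maj (Pos-snoc-suc x b)) ⟩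
  inv₀ 0 x + maj (Pos x ∷ʳ suc b)                   ≡⟨ cong (λ p → inv₀ 0 x + maj (p ∷ʳ suc b)) e ⟩
  inv₀ 0 x + maj (reverse v ∷ʳ suc b)               ≡⟨ cong (inv₀ 0 x +_) (maj-snoc v (suc b)) ⟩
  inv₀ 0 x + (maj (reverse v) + descent (suc b) v)  ≡⟨ +-assoc (inv₀ 0 x) _ _ ⟨
  inv₀ 0 x + maj (reverse v) + descent (suc b) v    ≡⟨ cong (λ p → inv₀ 0 x + maj p + descent (suc b) v) e ⟨
  inv₀ 0 x + maj (Pos x) + descent (suc b) v        ≡⟨ cong (_+ descent (suc b) v) (mafz≡ x) ⟨
  mafz x + descent (suc b) v                        ∎
  where open ≡-Reasoning

-- 0ᵐw is empty or ends in a positive letter.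
data Blocks : ℕ → Word → Set where
  done : Blocks 0 []
  zero : ∀ {m w} → Blocks (suc m) w → Blocks m (0 ∷ w)
  pos  : ∀ {m x w} → Blocks 0 w → Blocks m (suc x ∷ w)

blocks-snoc : ∀ m w a → Blocks m (w ∷ʳ suc a)
blocks-snoc m []          a = pos done
blocks-snoc m (0 ∷ w)     a = zero (blocks-snoc (suc m) w a)
blocks-snoc m (suc x ∷ w) a = pos (blocks-snoc 0 w a)

replicate-snoc : ∀ m (w : Word) → replicate m 0 ++ 0 ∷ w ≡ 0 ∷ replicate m 0 ++ w
replicate-snoc zero    w = refl
replicate-snoc (suc m) w = cong (0 ∷_) (replicate-snoc m w)

Pos-zeros : ∀ m w → Pos (replicate m 0 ++ w) ≡ Pos w
Pos-zeros zero    w = refl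
Pos-zeros (suc m) w = Pos-zeros m w

inv₀-zeros : ∀ m r w → inv₀ r (replicate m 0 ++ w) ≡ m * r + inv₀ r w
inv₀-zeros zero    r w = refl
inv₀-zeros (suc m) r w = trans (cong (r +_) (inv₀-zeros m r w)) (sym (+-assoc r (m * r) _))

length-zeros : ∀ m (w : Word) → length (replicate m 0 ++ w) ≡ m + length w
length-zeros zero    w = refl
length-zeros (suc m) w = cong suc (length-zeros m w)

Pos-γ : ∀ m w → Pos (γ m w) ≡ Pos w
Pos-γ m []          = trans (cong Pos (sym (++-identityʳ (replicate m 0)))) (Pos-zeros m [])
Pos-γ m (0 ∷ w)     = Pos-γ (suc m) w
Pos-γ m (suc x ∷ w) = cong (suc x ∷_) (trans (Pos-zeros m _) (Pos-γ 0 w))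

length-γ : ∀ m w → length (γ m w) ≡ m + length w
length-γ m []          = trans (length-replicate m) (sym (+-identityʳ m))
length-γ m (0 ∷ w)     = trans (length-γ (suc m) w) (sym (+-suc m _))
length-γ m (suc x ∷ w) = trans (cong suc (trans (length-zeros m _) (cong (m +_) (length-γ 0 w)))) (sym (+-suc m _))

-- Within a block each zero jumps over exactly one positive letter and so gains one pair; the total
-- gain is the number of zeros, `m + length w` minus `length (Pos w)`. The term `m * r` accounts for
-- the pending zeros.
inv₀-γ : ∀ {m w} r → Blocks m w →
         inv₀ r (γ m w) + length (Pos w) ≡ m * r + inv₀ r w + (m + length w)
inv₀-γ r done = refl
inv₀-γ {m} {0 ∷ w} r (zero b) = trans (inv₀-γ r b)
  (solve 4 (λ r m i l → (r :+ m :* r) :+ i :+ (con 1 :+ m :+ l) := m :* r :+ (r :+ i) :+ (m :+ (con 1 :+ l))) refl r m (inv₀ r w) (length w))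
  where open +-*-Solver
inv₀-γ {m} {suc x ∷ w} r (pos b) = begin
  inv₀ (suc r) (replicate m 0 ++ γ 0 w) + suc (length (Pos w))
    ≡⟨ cong (_+ suc (length (Pos w))) (inv₀-zeros m (suc r) (γ 0 w)) ⟩
  m * suc r + inv₀ (suc r) (γ 0 w) + suc (length (Pos w))
    ≡⟨ solve 4 (λ m r i l → m :* (con 1 :+ r) :+ i :+ (con 1 :+ l) := m :* (con 1 :+ r) :+ con 1 :+ (i :+ l)) refl m r (inv₀ (suc r) (γ 0 w)) (length (Pos w)) ⟩
  m * suc r + 1 + (inv₀ (suc r) (γ 0 w) + length (Pos w))
    ≡⟨ cong (m * suc r + 1 +_) (inv₀-γ (suc r) b) ⟩
  m * suc r + 1 + (inv₀ (suc r) w + length w)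
    ≡⟨ solve 4 (λ m r i l → m :* (con 1 :+ r) :+ con 1 :+ (i :+ l) := m :* r :+ i :+ (m :+ (con 1 :+ l))) refl m r (inv₀ (suc r) w) (length w) ⟩
  m * r + inv₀ (suc r) w + (m + suc (length w)) ∎
  where
  open ≡-Reasoning
  open +-*-Solver

γ≢0∷ : ∀ {m w u} → Blocks m w → γ m w ≢ 0 ∷ u
γ≢0∷ (zero b) e = γ≢0∷ b e

zeros-cancel : ∀ m m′ {u u′ : Word} → (∀ {v} → u ≢ 0 ∷ v) → (∀ {v} → u′ ≢ 0 ∷ v) →
               replicate m 0 ++ u ≡ replicate m′ 0 ++ u′ → m ≡ m′ × u ≡ u′
zeros-cancel zero    zero     _ _  e = refl , e
zeros-cancel zero    (suc m′) h _  e = ⊥-elim (h e)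
zeros-cancel (suc m) zero     _ h′ e = ⊥-elim (h′ (sym e))
zeros-cancel (suc m) (suc m′) h h′ e =
  let m≡ , u≡ = zeros-cancel m m′ h h′ (∷-injectiveʳ e) in cong suc m≡ , u≡

-- After the first positive letter the image shows the `m` pending zeros, and what follows them
-- never starts with a zero, so `m` can be read off.
γ-injective : ∀ {m m′ w w′} → Blocks m w → Blocks m′ w′ → γ m w ≡ γ m′ w′ →
              replicate m 0 ++ w ≡ replicate m′ 0 ++ w′
γ-injective {m} (zero {w = w} b) b′ e = trans (replicate-snoc m w) (γ-injective b b′ e)
γ-injective {m′ = m′} b (zero {w = w} b′) e = trans (γ-injective b b′ e) (sym (replicate-snoc m′ w))
γ-injective done done e = refl
γ-injective {m} {m′} (pos b) (pos b′) e with zeros-cancel m m′ (γ≢0∷ b) (γ≢0∷ b′) (∷-injectiveʳ e)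
... | refl , γ≡ rewrite ∷-injectiveˡ e = cong (λ u → replicate m 0 ++ _ ∷ u) (γ-injective b b′ γ≡)

-- The map 𝐅₃

-- Every rule leaves the last letter in place. Hence the letter stripped by the rotation is known to
-- be a zero, and the argument of `γ` is known to end in a positive letter.
append-last : ∀ m u F b → ∃[ w ] append m u F b ≡ w ∷ʳ b
append-last nothing        u F b = u , refl
append-last (just (a , r)) u F b with a ≤? b | r
... | yes _ | _     = F , refl
... | no  _ | suc _ = 0 ∷ F [ 1 ⋯ length F ∸ 1 ] , refl
... | no  _ | zero  = γ 0 F , refl

lastPositive-view : ∀ u → (lastPositive u ≡ nothing × Pos u ≡ []) ⊎
  (∃[ a ] ∃[ r ] ∃[ v ] u ≡ replicate r 0 ++ suc a ∷ v × lastPositive u ≡ just (suc a , r))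
lastPositive-view []          = inj₁ (refl , refl)
lastPositive-view (suc a ∷ u) = inj₂ (a , 0 , u , refl , refl)
lastPositive-view (0 ∷ u) with lastPositive-view u
... | inj₁ (e , e′)               = inj₁ (cong (Maybe.map _) e , e′)
... | inj₂ (a , r , v , refl , e) = inj₂ (a , suc r , v , refl , cong (Maybe.map _) e)

𝐅₃-zeros : ∀ u → Pos u ≡ [] → 𝐅₃-rev u ≡ reverse u
𝐅₃-zeros []      _ = refl
𝐅₃-zeros (0 ∷ u) e with lastPositive-view u
... | inj₁ (l , _) rewrite l = sym (unfold-reverse 0 u)
... | inj₂ (a , r , v , refl , _) with () ← trans (sym e) (Pos-zeros r (suc a ∷ v))

-- `descent b (Pos u)` is the growth of `mafz` caused by appending `b`, and `descent b u` that of
-- `maj`. Their discrepancy is what each rule has to compensate: nothing for `keep`, the number of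
-- positive letters for `rotate`, the number of zeros for `γ-move`. The case `keep` includes words
-- `u` of zeros.
data Step (b : ℕ) (u : Word) : Word → Set where
  keep   : descent b (Pos u) ≡ 0 → descent b u ≡ 0 → Step b u (𝐅₃-rev u ∷ʳ b)
  rotate : ∀ w → 𝐅₃-rev u ≡ w ∷ʳ 0 →
           descent b (Pos u) ≡ length (Pos u) → 0 < length (Pos u) → descent b u ≡ 0 →
           Step b u (0 ∷ w ∷ʳ b)
  γ-move  : ∀ w a → 𝐅₃-rev u ≡ w ∷ʳ suc a →
           descent b (Pos u) ≡ length (Pos u) → 0 < length (Pos u) → descent b u ≡ length u →
           Step b u (γ 0 (𝐅₃-rev u) ∷ʳ b)

take-init : ∀ (w : Word) a → (w ∷ʳ a) [ 1 ⋯ length (w ∷ʳ a) ∸ 1 ] ≡ w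
take-init w a rewrite length-++ w {[ a ]} | m+n∸n≡m (length w) 1 = go w
  where
  go : ∀ w → take (length w) (w ∷ʳ a) ≡ w
  go []      = refl
  go (x ∷ w) = cong (x ∷_) (go w)

descent-yes : ∀ {b a} v → b < a → descent b (a ∷ v) ≡ suc (length v)
descent-yes {b} {a} v b<a rewrite dec-true (b <? a) b<a = refl

descent-no : ∀ {b a} v → a ≤ b → descent b (a ∷ v) ≡ 0
descent-no {b} {a} v a≤b rewrite dec-false (b <? a) (≤⇒≯ a≤b) = refl

step : ∀ b u → Step b u (𝐅₃-rev (b ∷ u))
step b u with lastPositive-view u
step b u | inj₁ (l , e) rewrite l = subst (λ F → Step b u (F ∷ʳ b)) (𝐅₃-zeros u e)
  (keep (cong (descent b) e) (descent-zeros u e))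
  where
  descent-zeros : ∀ u → Pos u ≡ [] → descent b u ≡ 0
  descent-zeros []      _ = refl
  descent-zeros (0 ∷ u) _ = refl
step b _ | inj₂ (a , zero , v , refl , _) with suc a ≤? b
... | yes a≤b = keep (descent-no (Pos v) a≤b) (descent-no v a≤b)
... | no  a≰b with append-last (lastPositive v) (reverse v) (𝐅₃-rev v) (suc a)
...   | w , e = γ-move w a e (descent-yes (Pos v) (≰⇒> a≰b)) z<s (descent-yes v (≰⇒> a≰b))
step b _ | inj₂ (a , suc r , v , refl , l) rewrite l with suc a ≤? b
... | yes a≤b = keep (trans (cong (descent b) (Pos-zeros r (suc a ∷ v))) (descent-no (Pos v) a≤b)) refl
... | no  a≰b = let w , e = append-last (lastPositive u) (reverse u) (𝐅₃-rev u) 0 in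
  subst (λ x → Step b (0 ∷ u) (0 ∷ x ∷ʳ b))
    (sym (trans (cong (λ F → F [ 1 ⋯ length F ∸ 1 ]) e) (take-init w 0)))
    (rotate w e (trans (cong (descent b) (Pos-zeros r (suc a ∷ v)))
                  (trans (descent-yes (Pos v) (≰⇒> a≰b)) (cong length (sym (Pos-zeros r (suc a ∷ v))))))
      (subst (0 <_) (cong length (sym (Pos-zeros r (suc a ∷ v)))) z<s) refl)
  where
  u = replicate r 0 ++ suc a ∷ v

Pos-reverse : ∀ u → Pos (reverse u) ≡ reverse (Pos u)
Pos-reverse []          = refl
Pos-reverse (0 ∷ u)     = trans (cong Pos (unfold-reverse 0 u)) (trans (Pos-snoc-0 (reverse u)) (Pos-reverse u))
Pos-reverse (suc a ∷ u) = trans (cong Pos (unfold-reverse (suc a) u)) (trans (Pos-snoc-suc (reverse u) a)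
  (trans (cong (_∷ʳ suc a) (Pos-reverse u)) (sym (unfold-reverse (suc a) (Pos u)))))

Pos-step : ∀ {b u F} → Step b u F → ∃[ X ] F ≡ X ∷ʳ b × Pos X ≡ Pos (𝐅₃-rev u) × length X ≡ length (𝐅₃-rev u)
Pos-step {u = u} (keep _ _)      = 𝐅₃-rev u , refl , refl , refl
Pos-step (rotate w e _ _ _)  rewrite e = 0 ∷ w , refl , sym (Pos-snoc-0 w) , length-++-comm [ 0 ] w
Pos-step {u = u} (γ-move _ _ _ _ _ _) = γ 0 (𝐅₃-rev u) , refl , Pos-γ 0 (𝐅₃-rev u) , length-γ 0 (𝐅₃-rev u)

length-snoc : ∀ (w : Word) b → length (w ∷ʳ b) ≡ suc (length w)
length-snoc w b = length-++-comm w [ b ]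

Pos-length-𝐅₃-rev : ∀ u → Pos (𝐅₃-rev u) ≡ Pos (reverse u) × length (𝐅₃-rev u) ≡ length u
Pos-length-𝐅₃-rev []      = refl , refl
Pos-length-𝐅₃-rev (b ∷ u) with Pos-step (step b u) | Pos-length-𝐅₃-rev u
... | X , e , p , l | p′ , l′ rewrite e | unfold-reverse b u =
  Pos-cong-snoc X (reverse u) b (trans p p′) , trans (length-snoc X b) (cong suc (trans l l′))

Pos-𝐅₃-rev : ∀ u → Pos (𝐅₃-rev u) ≡ reverse (Pos u)
Pos-𝐅₃-rev u = trans (proj₁ (Pos-length-𝐅₃-rev u)) (Pos-reverse u)

length-Pos-𝐅₃-rev : ∀ u → length (Pos (𝐅₃-rev u)) ≡ length (Pos u)
length-Pos-𝐅₃-rev u = trans (cong length (Pos-𝐅₃-rev u)) (length-reverse (Pos u))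

mafz-𝐅₃-rev : ∀ u → mafz (𝐅₃-rev u) ≡ maj (reverse u)
mafz-𝐅₃-rev []      = refl
mafz-𝐅₃-rev (b ∷ u) = trans (mafz-step (step b u)) (trans (sym (maj-snoc u b)) (cong maj (sym (unfold-reverse b u))))
  where
  open ≡-Reasoning
  open +-*-Solver
  G = 𝐅₃-rev u
  X-snoc : ∀ X → Pos X ≡ Pos G → mafz (X ∷ʳ b) ≡ mafz X + descent b (Pos u)
  X-snoc X e = mafz-snoc X (Pos u) b (trans e (Pos-𝐅₃-rev u)) (Pos-all-positive u)
  mafz-step : ∀ {F} → Step b u F → mafz F ≡ maj (reverse u) + descent b u
  mafz-step (keep d₁ d₂) = begin
    mafz (G ∷ʳ b)               ≡⟨ X-snoc G refl ⟩
    mafz G + descent b (Pos u)  ≡⟨ cong₂ _+_ (mafz-𝐅₃-rev u) (trans d₁ (sym d₂)) ⟩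
    maj (reverse u) + descent b u ∎
  mafz-step (rotate w e d₁ _ d₂) = begin
    mafz (0 ∷ w ∷ʳ b)                     ≡⟨ X-snoc (0 ∷ w) (trans (sym (Pos-snoc-0 w)) (cong Pos (sym e))) ⟩
    mafz (0 ∷ w) + descent b (Pos u)      ≡⟨ cong₂ _+_ (mafz≡ (0 ∷ w)) (trans d₁ |Pos|) ⟩
    inv₀ 0 w + maj (Pos w) + length (Pos w)    ≡⟨ solve 3 (λ i m l → i :+ m :+ l := i :+ l :+ m) refl (inv₀ 0 w) (maj (Pos w)) (length (Pos w)) ⟩
    inv₀ 0 w + length (Pos w) + maj (Pos w)    ≡⟨ cong₂ _+_ (inv₀-snoc-0 0 w) (cong maj (Pos-snoc-0 w)) ⟨
    inv₀ 0 (w ∷ʳ 0) + maj (Pos (w ∷ʳ 0))  ≡⟨ mafz≡ (w ∷ʳ 0) ⟨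
    mafz (w ∷ʳ 0)                         ≡⟨ cong mafz e ⟨
    mafz G                                ≡⟨ mafz-𝐅₃-rev u ⟩
    maj (reverse u)                       ≡⟨ +-identityʳ _ ⟨
    maj (reverse u) + 0                   ≡⟨ cong (maj (reverse u) +_) d₂ ⟨
    maj (reverse u) + descent b u         ∎
    where
    |Pos| : length (Pos u) ≡ length (Pos w)
    |Pos| = trans (sym (length-Pos-𝐅₃-rev u)) (cong length (trans (cong Pos e) (Pos-snoc-0 w)))
  mafz-step (γ-move w a e d₁ _ d₂) = begin
    mafz (γ 0 G ∷ʳ b)                                       ≡⟨ X-snoc (γ 0 G) (Pos-γ 0 G) ⟩
    mafz (γ 0 G) + descent b (Pos u)                        ≡⟨ cong₂ _+_ (mafz≡ (γ 0 G)) (trans d₁ (sym (length-Pos-𝐅₃-rev u))) ⟩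
    inv₀ 0 (γ 0 G) + maj (Pos (γ 0 G)) + length (Pos G)     ≡⟨ solve 3 (λ i m l → i :+ m :+ l := i :+ l :+ m) refl (inv₀ 0 (γ 0 G)) (maj (Pos (γ 0 G))) (length (Pos G)) ⟩
    inv₀ 0 (γ 0 G) + length (Pos G) + maj (Pos (γ 0 G))     ≡⟨ cong₂ _+_ (inv₀-γ 0 G-blocks) (cong maj (Pos-γ 0 G)) ⟩
    inv₀ 0 G + length G + maj (Pos G)                       ≡⟨ solve 3 (λ i m l → i :+ l :+ m := i :+ m :+ l) refl (inv₀ 0 G) (maj (Pos G)) (length G) ⟩
    inv₀ 0 G + maj (Pos G) + length G                       ≡⟨ cong₂ _+_ (sym (mafz≡ G)) (proj₂ (Pos-length-𝐅₃-rev u)) ⟩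
    mafz G + length u                                       ≡⟨ cong₂ _+_ (mafz-𝐅₃-rev u) (sym d₂) ⟩
    maj (reverse u) + descent b u                           ∎
    where
    G-blocks : Blocks 0 G
    G-blocks = subst (Blocks 0) (sym e) (blocks-snoc 0 w a)

𝐅₃-rev-injective : ∀ u u′ → 𝐅₃-rev u ≡ 𝐅₃-rev u′ → u ≡ u′
𝐅₃-rev-injective [] u′ e with u′ | trans (cong length e) (proj₂ (Pos-length-𝐅₃-rev u′))
... | [] | _ = refl
𝐅₃-rev-injective u [] e with u | trans (cong length (sym e)) (proj₂ (Pos-length-𝐅₃-rev u))
... | [] | _ = refl
𝐅₃-rev-injective (b ∷ u) (b′ ∷ u′) e = split (step b u) (step b′ u′) e
  where
  G  = 𝐅₃-rev u
  G′ = 𝐅₃-rev u′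
  done⁺ : b ≡ b′ → G ≡ G′ → b ∷ u ≡ b′ ∷ u′
  done⁺ b≡ G≡ = cong₂ _∷_ b≡ (𝐅₃-rev-injective u u′ G≡)

  -- All rules preserve the positive subword, so the result determines `Pos u` and thereby whether
  -- `b` was smaller than the last positive letter. This separates `keep` from the two other cases.
  descent≡ : ∀ X X′ → b ≡ b′ → X ≡ X′ → Pos X ≡ Pos G → Pos X′ ≡ Pos G′ → descent b (Pos u) ≡ descent b′ (Pos u′)
  descent≡ X _ refl refl p p′ = cong (descent b) (reverse-injective {x = Pos u} {y = Pos u′}
    (trans (sym (Pos-𝐅₃-rev u)) (trans (sym p) (trans p′ (Pos-𝐅₃-rev u′)))))

  Pos-rotate : ∀ {w} {u} → 𝐅₃-rev u ≡ w ∷ʳ 0 → Pos (0 ∷ w) ≡ Pos (𝐅₃-rev u)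
  Pos-rotate {w} e = trans (sym (Pos-snoc-0 w)) (cong Pos (sym e))

  blocks : ∀ {w a u} → 𝐅₃-rev u ≡ w ∷ʳ suc a → Blocks 0 (𝐅₃-rev u)
  blocks {w} {a} e = subst (Blocks 0) (sym e) (blocks-snoc 0 w a)

  absurd : ∀ {d d′ l} → d ≡ 0 → d′ ≡ l → 0 < l → d ≢ d′
  absurd refl refl () refl

  split : ∀ {F F′} → Step b u F → Step b′ u′ F′ → F ≡ F′ → b ∷ u ≡ b′ ∷ u′
  split (keep _ _) (keep _ _) e = let X≡ , b≡ = ∷ʳ-injective G G′ e in done⁺ b≡ X≡
  split (keep d _) (rotate w e′ d′ l _) e =
    let X≡ , b≡ = ∷ʳ-injective G (0 ∷ w) e in contradiction (descent≡ G (0 ∷ w) b≡ X≡ refl (Pos-rotate {u = u′} e′)) (absurd d d′ l)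
  split (keep d _) (γ-move _ _ _ d′ l _) e =
    let X≡ , b≡ = ∷ʳ-injective G (γ 0 G′) e in contradiction (descent≡ G (γ 0 G′) b≡ X≡ refl (Pos-γ 0 G′)) (absurd d d′ l)
  split (rotate w e′ d′ l _) (keep d _) e =
    let X≡ , b≡ = ∷ʳ-injective (0 ∷ w) G′ e in contradiction (sym (descent≡ (0 ∷ w) G′ b≡ X≡ (Pos-rotate {u = u} e′) refl)) (absurd d d′ l)
  split (γ-move _ _ _ d′ l _) (keep d _) e =
    let X≡ , b≡ = ∷ʳ-injective (γ 0 G) G′ e in contradiction (sym (descent≡ (γ 0 G) G′ b≡ X≡ (Pos-γ 0 G) refl)) (absurd d d′ l)
  split (rotate w e₁ _ _ _) (rotate w′ e₂ _ _ _) e =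
    let X≡ , b≡ = ∷ʳ-injective (0 ∷ w) (0 ∷ w′) e in
    done⁺ b≡ (trans e₁ (trans (cong (_∷ʳ 0) (∷-injectiveʳ X≡)) (sym e₂)))
  split (γ-move _ _ e₁ _ _ _) (γ-move _ _ e₂ _ _ _) e =
    let X≡ , b≡ = ∷ʳ-injective (γ 0 G) (γ 0 G′) e in
    done⁺ b≡ (γ-injective (blocks {u = u} e₁) (blocks {u = u′} e₂) X≡)
  split (rotate w _ _ _ _) (γ-move _ _ e₂ _ _ _) e =
    let X≡ , _ = ∷ʳ-injective (0 ∷ w) (γ 0 G′) e in contradiction (sym X≡) (γ≢0∷ (blocks {u = u′} e₂))
  split (γ-move _ _ e₁ _ _ _) (rotate w _ _ _ _) e =
    let X≡ , _ = ∷ʳ-injective (γ 0 G) (0 ∷ w) e in contradiction X≡ (γ≢0∷ (blocks {u = u} e₁))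

Pos-𝐅₃ : ∀ w → Pos (𝐅₃ w) ≡ Pos w
Pos-𝐅₃ w = trans (proj₁ (Pos-length-𝐅₃-rev (reverse w))) (cong Pos (reverse-involutive w))

length-𝐅₃ : ∀ w → length (𝐅₃ w) ≡ length w
length-𝐅₃ w = trans (proj₂ (Pos-length-𝐅₃-rev (reverse w))) (length-reverse w)

mafz-𝐅₃ : ∀ w → mafz (𝐅₃ w) ≡ maj w
mafz-𝐅₃ w = trans (mafz-𝐅₃-rev (reverse w)) (cong maj (reverse-involutive w))

𝐅₃-injective : ∀ {w w′} → 𝐅₃ w ≡ 𝐅₃ w′ → w ≡ w′
𝐅₃-injective {w} {w′} e = reverse-injective (𝐅₃-rev-injective (reverse w) (reverse w′) e)

-- Words with marked zeros

-- A subexcedent letter is marked sub, any other positive letter exc; z is a zero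
-- that is still to be moved, z* one that has been moved.
data Letter : Set where
  z z* : Letter
  sub exc  : ℕ → Letter

mark : ℕ → ℕ → Letter
mark r x = if does (x ≤? r) then sub x else exc x

markZero : ℕ → Letter
markZero zero    = z*
markZero (suc _) = z

-- The first l zeros of the word are still to be moved, and r positive letters
-- precede the word.
marks : ℕ → ℕ → Word → List Letter
marks l r []          = []
marks l r (0 ∷ w)     = markZero l ∷ marks (pred l) r w
marks l r (suc x ∷ w) = mark r (suc x) ∷ marks l (suc r) w

unmark : Letter → ℕ
unmark z     = 0
unmark z*    = 0
unmark (sub x) = x
unmark (exc x) = x

unmark-mark : ∀ r x → unmark (mark r x) ≡ x
unmark-mark r x with does (x ≤? r)
... | true  = refl
... | false = refl

unmark-marks : ∀ l r w → map unmark (marks l r w) ≡ w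
unmark-marks l       r []          = refl
unmark-marks zero    r (0 ∷ w)     = cong (0 ∷_) (unmark-marks zero r w)
unmark-marks (suc l) r (0 ∷ w)     = cong (0 ∷_) (unmark-marks l r w)
unmark-marks l       r (suc x ∷ w) = cong₂ _∷_ (unmark-mark r (suc x)) (unmark-marks l (suc r) w)

marks-injective : ∀ {l r} w w′ → marks l r w ≡ marks l r w′ → w ≡ w′
marks-injective {l} {r} w w′ h =
  trans (sym (unmark-marks l r w)) (trans (cong (map unmark) h) (unmark-marks l r w′))

-- The letters are compared as z < sub x < z* < exc x.  For the original zeros this
-- is the order of the word w, for the moved ones that of the permutation
-- ZDer⁻¹ w, in which a subexcedent letter at i stands for a value less than i.
rise : Letter → Letter → Bool
rise z     _     = true
rise (sub _) z     = false
rise (sub x) (sub y) = does (x ≤? y)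
rise (sub _) z*    = true
rise (sub _) (exc _) = true
rise z*    z     = false
rise z*    (sub _) = false
rise z*    z*    = true
rise z*    (exc _) = true
rise (exc _) z     = false
rise (exc _) (sub _) = false
rise (exc _) z*    = false
rise (exc x) (exc y) = does (x ≤? y)

module _ {A : Set} (r : A → A → Bool) where

  -- True stands for a rise; the last position is one.
  pattern-from : A → List A → List Bool
  pattern-from y []       = [ true ]
  pattern-from y (x ∷ xs) = r y x ∷ pattern-from x xs

NonSub : Letter → Set
NonSub (sub _) = ⊥
NonSub _     = ⊤

Above Below : ℕ → Letter → Set
Above a (sub b) = a < b
Above a _     = ⊤
Below a (sub b) = b < a
Below a _     = ⊤

-- The letter following the zero that is being moved cannot be z, as the zeros
-- are moved from right to left.
onHead : (Letter → Set) → List Letter → Set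
onHead P []      = ⊤
onHead P (z ∷ _) = ⊥
onHead P (x ∷ _) = P x

-- Required of the letters skipped before the moved zero. It keeps `skip` apart from `stay` and
-- `left`, whose results begin with `z*`.
Unmoved : Letter → Set
Unmoved z* = ⊥
Unmoved _  = ⊤

-- SlideRight a T T′: a zero immediately to the right of the letter sub a of the
-- word sub a ∷ T ends up, in T′, at the end of the increasing run of sub a.
data SlideRight : ℕ → List Letter → List Letter → Set where
  stop : ∀ {a q} → onHead (Below a) q → SlideRight a q (z* ∷ q)
  next : ∀ {a b T T′} → a < b → SlideRight b T T′ → SlideRight a (sub b ∷ T) (sub b ∷ T′)

-- SlideLeft a T T′: the decreasing run of sub a in sub a ∷ T is followed by a zero,
-- which is deleted in T′.
data SlideLeft : ℕ → List Letter → List Letter → Set where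
  stop : ∀ {a q} → onHead (Above a) q → SlideLeft a (z ∷ q) q
  next : ∀ {a b T T′} → b < a → SlideLeft b T T′ → SlideLeft a (sub b ∷ T) (sub b ∷ T′)

-- Move y T T′: one of the zeros of T is moved, y being the letter before T.
data Move : Letter → List Letter → List Letter → Set where
  skip  : ∀ {y x T T′} → Unmoved x → Move x T T′ → Move y (x ∷ T) (x ∷ T′)
  stay  : ∀ {y q} → NonSub y → onHead NonSub q → Move y (z ∷ q) (z* ∷ q)
  right : ∀ {y a T T′} → Above a y → SlideRight a T T′ → Move y (z ∷ sub a ∷ T) (sub a ∷ T′)
  left  : ∀ {y a T T′} → Below a y → SlideLeft a T T′ → Move y (sub a ∷ T) (z* ∷ sub a ∷ T′)

-- Injectivity of moves and invariance of the pattern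

slideRight-injective : ∀ {a T₁ T₂ T′} → SlideRight a T₁ T′ → SlideRight a T₂ T′ → T₁ ≡ T₂
slideRight-injective (stop _)   (stop _)   = refl
slideRight-injective (next _ h) (next _ k) = cong (_ ∷_) (slideRight-injective h k)

-- The zero has disappeared from `T′`, but its place is recovered as the point where the decreasing
-- run of `a` breaks off: `stop` and `next` demand opposite comparisons with the following
-- subexcedent letter.
slideLeft-injective : ∀ {a T₁ T₂ T′} → SlideLeft a T₁ T′ → SlideLeft a T₂ T′ → T₁ ≡ T₂
slideLeft-injective (stop _)     (stop _)     = refl
slideLeft-injective (stop a<b)   (next b<a _) = contradiction a<b (<⇒≯ b<a)
slideLeft-injective (next b<a _) (stop a<b)   = contradiction a<b (<⇒≯ b<a)
slideLeft-injective (next _ h)   (next _ k)   = cong (_ ∷_) (slideLeft-injective h k)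

-- A right slide climbs at each step, whereas a `right` move starting behind a subexcedent letter
-- needs a descent there. At the landing place the zero follows a subexcedent letter, which excludes
-- `stay`, and the next subexcedent letter is smaller, which excludes `left`.
slideRight-move : ∀ {a T₁ T₂ T′} → SlideRight a T₁ T′ → ¬ Move (sub a) T₂ T′
slideRight-move (stop b<a)   (left a<b _)  = <⇒≯ b<a a<b
slideRight-move (next a<b _) (right b<a _) = <⇒≯ b<a a<b
slideRight-move (next _ h)   (skip _ m)    = slideRight-move h m

move-injective : ∀ {y T₁ T₂ T′} → Move y T₁ T′ → Move y T₂ T′ → T₁ ≡ T₂
move-injective (skip _ m)  (skip _ m′)  = cong (_ ∷_) (move-injective m m′)
move-injective (skip _ m)  (right _ h)  = contradiction m (slideRight-move h)
move-injective (right _ h) (skip _ m)   = contradiction m (slideRight-move h)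
move-injective (right _ h) (right _ h′) = cong (λ T → z ∷ sub _ ∷ T) (slideRight-injective h h′)
move-injective (stay _ _)  (stay _ _)   = refl
move-injective (left _ h)  (left _ h′)  = cong (sub _ ∷_) (slideLeft-injective h h′)

-- The run consists of rises, `z` before it makes a rise, and so does its last letter before `z*`:
-- the rises merely shift by one. Behind the run, `z*` compares with the next letter as the last
-- letter of the run did.
slideRight-pattern : ∀ {a T T′} → SlideRight a T T′ →
  true ∷ pattern-from rise (sub a) T ≡ pattern-from rise (sub a) T′
slideRight-pattern (stop {q = []}       _) = refl
slideRight-pattern (stop {q = z* ∷ _}   _) = refl
slideRight-pattern (stop {q = exc _ ∷ _}  _) = refl
slideRight-pattern (stop {a} {sub b ∷ _} b<a) rewrite dec-false (a ≤? b) (<⇒≱ b<a) = refl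
slideRight-pattern (next {a} {b} a<b h) rewrite dec-true (a ≤? b) (<⇒≤ a<b) = cong (true ∷_) (slideRight-pattern h)

-- Dually, a descent into `z` at the end of the run is traded for a descent from `z*` at its front,
-- and the last letter of the run makes a rise before `q`, as `z` did.
slideLeft-pattern : ∀ {a T T′} → SlideLeft a T T′ →
  pattern-from rise (sub a) T ≡ false ∷ pattern-from rise (sub a) T′
slideLeft-pattern (stop {q = []}       _) = refl
slideLeft-pattern (stop {q = z* ∷ _}   _) = refl
slideLeft-pattern (stop {q = exc _ ∷ _}  _) = refl
slideLeft-pattern (stop {a} {sub b ∷ _} a<b) rewrite dec-true (a ≤? b) (<⇒≤ a<b) = refl
slideLeft-pattern (next {a} {b} b<a h) rewrite dec-false (a ≤? b) (<⇒≱ b<a) = cong (false ∷_) (slideLeft-pattern h)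

move-pattern : ∀ {y T T′} → Unmoved y → Move y T T′ → pattern-from rise y T ≡ pattern-from rise y T′
move-pattern _ (skip u m) = cong (_ ∷_) (move-pattern u m)
move-pattern u (stay {y} {q} nonSub nonSubʳ) = cong₂ _∷_ (leftmost y u nonSub) (rightmost q nonSubʳ)
  where
  leftmost : ∀ y → Unmoved y → NonSub y → rise y z ≡ rise y z*
  leftmost z     _ _ = refl
  leftmost (exc _) _ _ = refl
  rightmost : ∀ q → onHead NonSub q → pattern-from rise z q ≡ pattern-from rise z* q
  rightmost []         _ = refl
  rightmost (z* ∷ _)   _ = refl
  rightmost (exc _ ∷ _)  _ = refl
move-pattern _ (right {y} {a} above h) = cong₂ _∷_ (boundary y above) (slideRight-pattern h)
  where
  boundary : ∀ y → Above a y → rise y z ≡ rise y (sub a)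
  boundary z     _ = refl
  boundary z*    _ = refl
  boundary (exc _) _ = refl
  boundary (sub b) a<b rewrite dec-false (b ≤? a) (<⇒≱ a<b) = refl
move-pattern u (left {y} {a} below h) = cong₂ _∷_ (boundary y u below) (slideLeft-pattern h)
  where
  boundary : ∀ y → Unmoved y → Below a y → rise y (sub a) ≡ rise y z*
  boundary z     _ _ = refl
  boundary (exc _) _ _ = refl
  boundary (sub b) _ b<a rewrite dec-true (b ≤? a) (<⇒≤ b<a) = refl

slideRight-Pos : ∀ {a T T′} → SlideRight a T T′ → Pos (map unmark T′) ≡ Pos (map unmark T)
slideRight-Pos (stop _)            = refl
slideRight-Pos (next {b = zero}  _ h)  = slideRight-Pos h
slideRight-Pos (next {b = suc b} _ h)  = cong (suc b ∷_) (slideRight-Pos h)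

slideLeft-Pos : ∀ {a T T′} → SlideLeft a T T′ → Pos (map unmark T′) ≡ Pos (map unmark T)
slideLeft-Pos (stop _)            = refl
slideLeft-Pos (next {b = zero}  _ h)  = slideLeft-Pos h
slideLeft-Pos (next {b = suc b} _ h)  = cong (suc b ∷_) (slideLeft-Pos h)

slideRight-length : ∀ {a T T′} → SlideRight a T T′ → length T′ ≡ suc (length T)
slideRight-length (stop _)   = refl
slideRight-length (next _ h) = cong suc (slideRight-length h)

slideLeft-length : ∀ {a T T′} → SlideLeft a T T′ → suc (length T′) ≡ length T
slideLeft-length (stop _)   = refl
slideLeft-length (next _ h) = cong suc (slideLeft-length h)

Pos-∷ : ∀ x {w w′} → Pos w ≡ Pos w′ → Pos (x ∷ w) ≡ Pos (x ∷ w′)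
Pos-∷ zero    h = h
Pos-∷ (suc x) h = cong (suc x ∷_) h

move-Pos : ∀ {y T T′} → Move y T T′ → Pos (map unmark T′) ≡ Pos (map unmark T)
move-Pos (skip {x = x} _ m)      = Pos-∷ (unmark x) (move-Pos m)
move-Pos (stay _ _)      = refl
move-Pos (right {a = a} _ h) = Pos-∷ a (slideRight-Pos h)
move-Pos (left {a = a} _ h)  = Pos-∷ a (slideLeft-Pos h)

move-length : ∀ {y T T′} → Move y T T′ → length T′ ≡ length T
move-length (skip _ m)  = cong suc (move-length m)
move-length (stay _ _)  = refl
move-length (right _ h) = cong suc (slideRight-length h)
move-length (left _ h)  = cong suc (slideLeft-length h)

-- Patterns of a word and of the corresponding permutation

rises-from : ℕ → List Bool → List ℕ
rises-from i []          = []
rises-from i (true ∷ p)  = i ∷ rises-from (suc i) p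
rises-from i (false ∷ p) = rises-from (suc i) p

descents-from : ℕ → List Bool → List ℕ
descents-from i []          = []
descents-from i (true ∷ p)  = descents-from (suc i) p
descents-from i (false ∷ p) = i ∷ descents-from (suc i) p

_≤ᴮ_ : ℕ → ℕ → Bool
x ≤ᴮ y = does (x ≤? y)

pattern-of : Word → List Bool
pattern-of []      = []
pattern-of (x ∷ w) = pattern-from _≤ᴮ_ x w

RISE-pattern : ∀ i w → RISE-from i w ≡ rises-from i (pattern-of w)
RISE-pattern i []          = refl
RISE-pattern i (x ∷ [])    = refl
RISE-pattern i (x ∷ y ∷ w) with does (x ≤? y) | RISE-pattern (suc i) (y ∷ w)
... | true  | h = cong (i ∷_) h
... | false | h = h

does-<-not-≤ : ∀ x y → does (y <? x) ≡ not (does (x ≤? y))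
does-<-not-≤ x y with x ≤? y
... | yes x≤y = trans (dec-false (y <? x) (≤⇒≯ x≤y)) (cong not (sym (dec-true (x ≤? y) x≤y)))
... | no  x≰y = trans (dec-true (y <? x) (≰⇒> x≰y)) (cong not (sym (dec-false (x ≤? y) x≰y)))

DES-pattern : ∀ i w → DES-from i w ≡ descents-from i (pattern-of w)
DES-pattern i []          = refl
DES-pattern i (x ∷ [])    = refl
DES-pattern i (x ∷ y ∷ w)
  with does (y <? x) | does (x ≤? y) | does-<-not-≤ x y | DES-pattern (suc i) (y ∷ w)
... | .false | true  | refl | h = h
... | .true  | false | refl | h = cong (i ∷_) h

tail : ∀ {A : Set} → List A → List A
tail []       = []
tail (_ ∷ xs) = xs

-- Patterns are computed with an artificial letter in front, so that each zero has a left neighbour;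
-- on marked words `z` plays this part, being non-subexcedent like the conventional letter at
-- position 0. `tail` discards the comparison with it.
pattern-tail : ∀ x w → tail (pattern-from _≤ᴮ_ x w) ≡ pattern-of w
pattern-tail x []      = refl
pattern-tail x (y ∷ w) = refl

Free : ℕ → Word → Set
Free r w = All (λ (i , x) → x ≢ i) (enumFrom (suc r) (Pos w))

mark-s : ∀ {r x} → x ≤ r → mark r x ≡ sub x
mark-s {r} {x} x≤r rewrite dec-true (x ≤? r) x≤r = refl

mark-e : ∀ {r x} → r < x → mark r x ≡ exc x
mark-e {r} {x} r<x rewrite dec-false (x ≤? r) (<⇒≱ r<x) = refl

does-≤-yes : ∀ {x y} → x ≤ y → does (x ≤? y) ≡ true
does-≤-yes {x} {y} = dec-true (x ≤? y)

does-≤-no : ∀ {x y} → y < x → does (x ≤? y) ≡ false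
does-≤-no {x} {y} y<x = dec-false (x ≤? y) (<⇒≱ y<x)

-- The letters stand at reduced positions `r + 1` and `r + 2`. Subexcedent before excedent gives
-- `x ≤ r < y`. Excedent before subexcedent gives `y ≤ r + 1 < x`, where strictness comes from `x`
-- not being fixed.
rise-mark : ∀ r x y → x ≢ suc r → does (x ≤? y) ≡ rise (mark r x) (mark (suc r) y)
rise-mark r x y x≢ with x ≤? r | y ≤? suc r
... | yes x≤r | yes y≤r rewrite mark-s x≤r | mark-s y≤r = refl
... | no  x≰r | no  y≰r rewrite mark-e (≰⇒> x≰r) | mark-e (≰⇒> y≰r) = refl
... | yes x≤r | no  y≰r rewrite mark-s x≤r | mark-e (≰⇒> y≰r) =
  does-≤-yes (≤-trans x≤r (≤-trans (n≤1+n r) (<⇒≤ (≰⇒> y≰r))))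
... | no  x≰r | yes y≤r rewrite mark-e (≰⇒> x≰r) | mark-s y≤r =
  does-≤-no (≤-<-trans y≤r (≤∧≢⇒< (≰⇒> x≰r) (≢-sym x≢)))

rise-z : ∀ r x → rise (mark r x) z ≡ false
rise-z r x with does (x ≤? r)
... | true  = refl
... | false = refl

zeros : Word → ℕ
zeros []          = 0
zeros (0 ∷ w)     = suc (zeros w)
zeros (suc _ ∷ w) = zeros w

-- The letter before `w` may be a zero or positive, hence a joint induction on two statements. A
-- positive previous letter is itself counted in `r`, so its mark uses `r′ = r - 1`.
unmoved-pattern : ∀ l r w → zeros w ≤ l → Free r w →
  (pattern-from _≤ᴮ_ 0 w ≡ pattern-from rise z (marks l r w)) ×
  (∀ r′ x → r ≡ suc r′ → suc x ≢ r → pattern-from _≤ᴮ_ (suc x) w ≡ pattern-from rise (mark r′ (suc x)) (marks l r w))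
unmoved-pattern l r []          h free = refl , λ _ _ _ _ → refl
unmoved-pattern (suc l) r (0 ∷ w) (s≤s h) free =
  let ih , _ = unmoved-pattern l r w h free in
  cong (true ∷_) ih , λ r′ x _ _ → cong₂ _∷_ (sym (rise-z r′ (suc x))) ih
unmoved-pattern l r (suc x ∷ w) h (x≢ ∷ free) =
  let _ , ih = unmoved-pattern l (suc r) w h free
      tl = ih r x refl x≢ in
  cong (true ∷_) tl , λ { r′ y refl y≢ → cong₂ _∷_ (rise-mark r′ (suc y) (suc x) y≢) tl }

!-mono-< : ∀ {js t u} → Sorted js → 0 < t → t < u → u ≤ length js → js ! t < js ! u
!-mono-< {j ∷ js} {1} {suc (suc u)} (j<js ∷ _) _ _ (s≤s u≤) = All.lookup j<js (!-∈ z<s u≤)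
!-mono-< {j ∷ js} {1} {1} _ _ (s≤s ()) _
!-mono-< {j ∷ js} {suc (suc t)} {suc (suc u)} (_ ∷ js↗) _ (s≤s t<u) (s≤s u≤) = !-mono-< js↗ z<s t<u u≤

All-!-++ˡ : ∀ {P : ℕ → Set} {xs} ys {t} → All P xs → 0 < t → t ≤ length xs → P ((xs ++ ys) ! t)
All-!-++ˡ ys {1}           (px ∷ _)   _ _        = px
All-!-++ˡ ys {suc (suc t)} (_ ∷ pxs) _ (s≤s t≤) = All-!-++ˡ ys pxs z<s t≤

All-!-++ʳ : ∀ {P : ℕ → Set} xs {ys t} → All P ys → length xs < t → t ≤ length (xs ++ ys) → P ((xs ++ ys) ! t)
All-!-++ʳ []       {ys} {t} pys 0<t t≤ = All.lookup pys (!-∈ {ys} 0<t t≤)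
All-!-++ʳ (x ∷ xs) {t = suc (suc t)} pys (s≤s l) (s≤s t≤) = All-!-++ʳ xs pys l t≤

nonZero-from : ℕ → Word → List ℕ
nonZero-from i w = map proj₁ (filter positive? (enumFrom i w))

nonZero-from-≥ : ∀ i w → All (i ≤_) (nonZero-from i w)
nonZero-from-≥ i []          = []
nonZero-from-≥ i (0 ∷ w)     = All.map <⇒≤ (nonZero-from-≥ (suc i) w)
nonZero-from-≥ i (suc _ ∷ w) = ≤-refl ∷ All.map <⇒≤ (nonZero-from-≥ (suc i) w)

module Moved (js : List ℕ) (js-sorted : Sorted js) where

  value : ℕ × ℕ → ℕ
  value (i , x) = if does (x ≟ 0) then i else js ! x

  values-from : ℕ → Word → Word
  values-from i w = map value (enumFrom i w)

  -- Reduces the comparison of a fixed value `i` with a value `js ! t` to that of `r` with `t`,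
  -- which is how marks are decided.
  record Cut (i r : ℕ) : Set where
    constructor cut
    field
      below : ∀ {t} → 0 < t → t ≤ r → js ! t < i
      above : ∀ {t} → r < t → t ≤ length js → i ≤ js ! t
  open Cut

  record Prefix (i r : ℕ) (w : Word) : Set where
    constructor prefix
    field
      ks   : List ℕ
      js≡  : js ≡ ks ++ nonZero-from i w
      |ks| : length ks ≡ r
      ks<  : All (_< i) ks

  prefix⇒cut : ∀ {i r w} → Prefix i r w → Cut i r
  prefix⇒cut {i} {w = w} (prefix ks refl refl ks<) = cut
    (λ 0<t t≤ → All-!-++ˡ (nonZero-from i w) ks< 0<t t≤)
    (λ r<t t≤ → All-!-++ʳ ks (nonZero-from-≥ i w) r<t t≤)

  prefix-0 : ∀ {i r w} → Prefix i r (0 ∷ w) → Prefix (suc i) r w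
  prefix-0 (prefix ks js≡ |ks| ks<) = prefix ks js≡ |ks| (All.map m<n⇒m<1+n ks<)

  prefix-suc : ∀ {i r x w} → Prefix i r (suc x ∷ w) → Prefix (suc i) (suc r) w
  prefix-suc {i} (prefix ks js≡ |ks| ks<) = prefix (ks ∷ʳ i)
    (trans js≡ (sym (++-assoc ks [ i ] _))) (trans (length-++-comm ks [ i ]) (cong suc |ks|))
    (All.++⁺ (All.map m<n⇒m<1+n ks<) (≤-refl ∷ []))

  does-≤-! : ∀ {x y} → 0 < x → x ≤ length js → 0 < y → y ≤ length js →
             does (js ! x ≤? js ! y) ≡ does (x ≤? y)
  does-≤-! {x} {y} 0<x x≤ 0<y y≤ with <-cmp x y
  ... | tri< x<y _ _ = trans (does-≤-yes (<⇒≤ (!-mono-< js-sorted 0<x x<y y≤))) (sym (does-≤-yes (<⇒≤ x<y)))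
  ... | tri≈ _ refl _ = trans (does-≤-yes {js ! x} ≤-refl) (sym (does-≤-yes {x} ≤-refl))
  ... | tri> _ _ y<x = trans (does-≤-no (!-mono-< js-sorted 0<y y<x x≤)) (sym (does-≤-no y<x))

  rise-z*ˡ : ∀ {i r x} → Cut i r → 0 < x → x ≤ length js → does (i ≤? js ! x) ≡ rise z* (mark r x)
  rise-z*ˡ {i} {r} {x} c 0<x x≤ with x ≤? r
  ... | yes x≤r rewrite mark-s x≤r = does-≤-no (below c 0<x x≤r)
  ... | no  x≰r rewrite mark-e (≰⇒> x≰r) = does-≤-yes (above c (≰⇒> x≰r) x≤)

  -- The letter `x` stands at position `i` and the fixed point at `i + 1`. As `x` is not fixed, its
  -- value is below `i` by the first cut or at least `i + 2` by the second.
  rise-z*ʳ : ∀ {i r x} → Cut i r → Cut (suc (suc i)) (suc r) → 0 < x → x ≤ length js → x ≢ suc r →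
             does (js ! x ≤? suc i) ≡ rise (mark r x) z*
  rise-z*ʳ {i} {r} {x} c c′ 0<x x≤ x≢ with x ≤? r
  ... | yes x≤r rewrite mark-s x≤r = does-≤-yes (≤-trans (<⇒≤ (below c 0<x x≤r)) (n≤1+n i))
  ... | no  x≰r rewrite mark-e (≰⇒> x≰r) = does-≤-no (above c′ (≤∧≢⇒< (≰⇒> x≰r) (≢-sym x≢)) x≤)

  moved-pattern : ∀ i r w → Prefix (suc i) r w → Free r w → All (_≤ length js) (Pos w) →
    (Cut i r → pattern-from _≤ᴮ_ i (values-from (suc i) w) ≡ pattern-from rise z* (marks 0 r w)) ×
    (∀ r′ x → r ≡ suc r′ → Cut i r′ → 0 < x → x ≤ length js → x ≢ r →
      pattern-from _≤ᴮ_ (js ! x) (values-from (suc i) w) ≡ pattern-from rise (mark r′ x) (marks 0 r w))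
  moved-pattern i r []      p free w≤ = (λ _ → refl) , λ _ _ _ _ _ _ _ → refl
  moved-pattern i r (0 ∷ w) p free w≤ =
    let ih , _ = moved-pattern (suc i) r w (prefix-0 p) free w≤
        tl = ih (prefix⇒cut p) in
    (λ _ → cong₂ _∷_ (does-≤-yes (n≤1+n i)) tl) ,
    λ { r′ x refl c 0<x x≤ x≢ → cong₂ _∷_ (rise-z*ʳ c (prefix⇒cut (prefix-0 p)) 0<x x≤ x≢) tl }
  moved-pattern i r (suc y ∷ w) p (y≢ ∷ free) (y≤ ∷ w≤) =
    let _ , ih = moved-pattern (suc i) (suc r) w (prefix-suc p) free w≤
        tl = ih r (suc y) refl (prefix⇒cut p) z<s y≤ y≢ in
    (λ c → cong₂ _∷_ (rise-z*ˡ c z<s y≤) tl) ,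
    λ { r′ x refl c 0<x x≤ x≢ → cong₂ _∷_ (trans (does-≤-! 0<x x≤ z<s y≤) (rise-mark r′ x (suc y) x≢)) tl }

zeros≤length : ∀ w → zeros w ≤ length w
zeros≤length []          = z≤n
zeros≤length (0 ∷ w)     = s≤s (zeros≤length w)
zeros≤length (suc _ ∷ w) = m≤n⇒m≤1+n (zeros≤length w)

pattern-unmoved : ∀ {n w} → DerWord n w → pattern-of w ≡ tail (pattern-from rise z (marks n 0 w))
pattern-unmoved {n} {w} (derWord len (derangement _ free)) =
  trans (sym (pattern-tail 0 w)) (cong tail (proj₁ (unmoved-pattern n 0 w
    (subst (zeros w ≤_) len (zeros≤length w)) (subst (All _) (enum≡enumFrom (Pos w)) free))))

pattern-moved : ∀ {n w} → DerWord n w → pattern-of (ZDer⁻¹ w) ≡ tail (pattern-from rise z (marks 0 0 w))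
pattern-moved {n} {w} w∈@(derWord len (derangement _ free)) =
  trans (cong (λ ps → pattern-of (map value ps)) (enum≡enumFrom w))
  (trans (sym (pattern-tail 0 (values-from 1 w)))
  -- Here the artificial letter is a moved zero at position 0 with value 0; it differs from `z` only
  -- in the first comparison, which `tail` drops.
  (trans (cong tail (proj₁ (moved-pattern 0 0 w
    (prefix [] (cong (map proj₁ ∘ filter positive?) (enum≡enumFrom w)) refl [])
    (subst (All _) (enum≡enumFrom (Pos w)) free) (All.map proj₂ bounds))
    (cut (λ 0<t t≤0 → contradiction t≤0 (<⇒≱ 0<t)) (λ _ _ → z≤n))))
  (tails (marks 0 0 w))))
  where
  open FromDerWord w∈ using (js; js-sorted; bounds)
  open Moved js js-sorted
  tails : ∀ T → tail (pattern-from rise z* T) ≡ tail (pattern-from rise z T)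
  tails []      = refl
  tails (_ ∷ _) = refl

-- Positions and factors of a word

last-∷ʳ : ∀ {A : Set} (xs : List A) x → last (xs ∷ʳ x) ≡ just x
last-∷ʳ []           x = refl
last-∷ʳ (_ ∷ [])     x = refl
last-∷ʳ (_ ∷ y ∷ xs) x = last-∷ʳ (y ∷ xs) x

module _ {P : Pred ℕ ℓ} (P? : Decidable P) where

  last-filter : ∀ n k → 0 < k → k ≤ n → P k → (∀ k′ → k < k′ → k′ ≤ n → ¬ P k′) →
                last (filter P? [1⋯ n ]) ≡ just k
  last-filter zero    (suc _) _ () _ _
  last-filter (suc n) k 0<k k≤ pk max with m≤n⇒m<n∨m≡n k≤
  ... | inj₂ refl = trans (cong last (trans split (cong (filter P? [1⋯ n ] ++_) (filter-accept P? pk))))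
                          (last-∷ʳ (filter P? [1⋯ n ]) (suc n))
    where
    split : filter P? [1⋯ suc n ] ≡ filter P? [1⋯ n ] ++ filter P? [ suc n ]
    split = trans (cong (filter P?) (sym (applyUpTo-∷ʳ suc n))) (filter-++ P? [1⋯ n ] [ suc n ])
  ... | inj₁ (s≤s k≤n) = trans (cong last drop-last)
                               (last-filter n k 0<k k≤n pk (λ k′ k< k′≤ → max k′ k< (m≤n⇒m≤1+n k′≤)))
    where
    drop-last : filter P? [1⋯ suc n ] ≡ filter P? [1⋯ n ]
    drop-last = begin
      filter P? [1⋯ suc n ]                      ≡⟨ cong (filter P?) (applyUpTo-∷ʳ suc n) ⟨
      filter P? ([1⋯ n ] ∷ʳ suc n)               ≡⟨ filter-++ P? [1⋯ n ] [ suc n ] ⟩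
      filter P? [1⋯ n ] ++ filter P? [ suc n ]   ≡⟨ cong (filter P? [1⋯ n ] ++_) (filter-reject P? (max (suc n) (s≤s k≤n) ≤-refl)) ⟩
      filter P? [1⋯ n ] ++ []                    ≡⟨ ++-identityʳ _ ⟩
      filter P? [1⋯ n ]                          ∎
      where open ≡-Reasoning

  head-filter : ∀ (f : ℕ → ℕ) n i → i < n → P (f i) → (∀ i′ → i′ < i → ¬ P (f i′)) →
                head (filter P? (applyUpTo f n)) ≡ just (f i)
  head-filter f (suc n) zero    _         pi min rewrite filter-accept P? {xs = applyUpTo (f ∘ suc) n} pi = refl
  head-filter f (suc n) (suc i) (s≤s i<n) pi min rewrite filter-reject P? {xs = applyUpTo (f ∘ suc) n} (min 0 z<s) =
    head-filter (f ∘ suc) n i i<n pi (λ i′ i′< → min (suc i′) (s<s i′<))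

drop-++ : ∀ (u v : Word) → drop (length u) (u ++ v) ≡ v
drop-++ []      v = refl
drop-++ (_ ∷ u) v = drop-++ u v

take-++ : ∀ (u v : Word) → take (length u) (u ++ v) ≡ u
take-++ []      v = refl
take-++ (x ∷ u) v = cong (x ∷_) (take-++ u v)

factor : ∀ t u v {w a b} → w ≡ t ++ u ++ v → a ≡ suc (length t) → b ≡ length t + length u → w [ a ⋯ b ] ≡ u
factor t u v refl refl refl
  rewrite m+n∸m≡n (length t) (length u) | drop-++ t (u ++ v) = take-++ u v

!-++ : ∀ (u : Word) x v → (u ++ x ∷ v) ! suc (length u) ≡ x
!-++ []      x v = refl
!-++ (_ ∷ u) x v = !-++ u x v

letter-at : ∀ u x v {w k} → w ≡ u ++ x ∷ v → k ≡ suc (length u) → w ! k ≡ x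
letter-at u x v refl refl = !-++ u x v

red-at : ∀ u v {w k} → w ≡ u ++ v → k ≡ length u → red w k ≡ length (Pos u)
red-at u v e k≡ = cong (length ∘ Pos) (factor [] u v e refl k≡)

Pos-++ : ∀ u v → Pos (u ++ v) ≡ Pos u ++ Pos v
Pos-++ = filter-++ (0 <?_)

length-Pos-++ : ∀ u v → length (Pos (u ++ v)) ≡ length (Pos u) + length (Pos v)
length-Pos-++ u v = trans (cong length (Pos-++ u v)) (length-++ (Pos u))

lastOr : Letter → List Letter → Letter
lastOr y []      = y
lastOr y (x ∷ T) = lastOr x T

lastOr-++ : ∀ y T U → lastOr y (T ++ U) ≡ lastOr (lastOr y T) U
lastOr-++ y []      U = refl
lastOr-++ y (x ∷ T) U = lastOr-++ x T U

move-skip : ∀ {y U U′} T → All Unmoved T → Move (lastOr y T) U U′ → Move y (T ++ U) (T ++ U′)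
move-skip []      _        m = m
move-skip (x ∷ T) (u ∷ us) m = skip u (move-skip T us m)

marks-++ : ∀ l r u v → marks (zeros u + l) r (u ++ v) ≡ marks (zeros u) r u ++ marks l (r + length (Pos u)) v
marks-++ l r []          v rewrite +-identityʳ r = refl
marks-++ l r (0 ∷ u)     v = cong (z ∷_) (marks-++ l r u v)
marks-++ l r (suc x ∷ u) v rewrite +-suc r (length (Pos u)) = cong (mark r (suc x) ∷_) (marks-++ l (suc r) u v)

mark-unmoved : ∀ r x → Unmoved (mark r x)
mark-unmoved r x with does (x ≤? r)
... | true  = tt
... | false = tt

marks-unmoved : ∀ r u → All Unmoved (marks (zeros u) r u)
marks-unmoved r []          = []
marks-unmoved r (0 ∷ u)     = tt ∷ marks-unmoved r u
marks-unmoved r (suc x ∷ u) = mark-unmoved r (suc x) ∷ marks-unmoved (suc r) u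

nonSub⇒above : ∀ {a} y → NonSub y → Above a y
nonSub⇒above z     _ = tt
nonSub⇒above z*    _ = tt
nonSub⇒above (exc _) _ = tt

-- Runs of subexcedent letters

NoRepeat : Word → Set
NoRepeat = Linked _≢_

-- b ∷ u is an increasing run of subexcedent letters, r letters precede u among
-- the positive letters, and the run is not continued by the first letter of v.
data Increasing : ℕ → ℕ → Word → Word → Set where
  stop : ∀ {r b v} → b < r → onHead (Below b) (marks 0 r v) → Increasing r b [] v
  next : ∀ {r b c u v} → b < suc c → Increasing (suc r) (suc c) u v → Increasing r b (suc c ∷ u) v

increasing : ∀ r b q → b < r → NoRepeat (b ∷ Pos q) →
             ∃[ u ] ∃[ v ] q ≡ u ++ v × Increasing r b u v
increasing r b []      b<r _ = [] , [] , refl , stop b<r tt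
increasing r b (0 ∷ q) b<r _ = [] , 0 ∷ q , refl , stop b<r tt
increasing r b (suc c ∷ q) b<r (b≢c ∷ nr) with suc c ≤? r
... | no  c≰r = [] , suc c ∷ q , refl , stop b<r (subst (λ x → onHead (Below b) (x ∷ marks 0 (suc r) q)) (sym (mark-e (≰⇒> c≰r))) tt)
... | yes c≤r with <-cmp b (suc c)
...   | tri< b<c _ _ = let u , v , q≡ , i = increasing (suc r) (suc c) q (s≤s c≤r) nr in
                       suc c ∷ u , v , cong (suc c ∷_) q≡ , next b<c i
...   | tri≈ _ b≡c _ = contradiction b≡c b≢c
...   | tri> _ _ c<b = [] , suc c ∷ q , refl , stop b<r (subst (λ x → onHead (Below b) (x ∷ marks 0 (suc r) q)) (sym (mark-s c≤r)) c<b)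

-- `Increasing` tests only the last letter of the run. Going back along the run the bound falls by
-- one per step and the letters by at least one, so all of them are subexcedent.
increasing-bound : ∀ {r b u v} → Increasing (suc r) b u v → b ≤ r
increasing-bound (stop b<r _) = ≤-pred b<r
increasing-bound (next b<c i) = ≤-trans (≤-pred b<c) (≤-pred (increasing-bound i))

increasing-slide : ∀ {r b u v} → Increasing r b u v → SlideRight b (marks 0 r (u ++ v)) (marks 0 r (u ++ 0 ∷ v))
increasing-slide (stop _ h) = stop h
increasing-slide (next {c = c} b<c i) rewrite mark-s (increasing-bound i) = next b<c (increasing-slide i)

-- The condition that defines rightEnd, for the word q following the zero and
-- the prefix of q of length t, when r positive letters precede the zero.
RightGood : ℕ → Word → ℕ → Set
RightGood r q t = Linked _<_ (take t q) × q ! t < r + length (Pos (take t q))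

length-Pos-≤ : ∀ u → length (Pos u) ≤ length u
length-Pos-≤ = length-filter (0 <?_)

linked-growth : ∀ c q t → t ≤ length q → Linked _<_ (take (suc t) (c ∷ q)) → c + t ≤ (c ∷ q) ! suc t
linked-growth c q       zero    _       _         = ≤-reflexive (+-identityʳ c)
linked-growth c (d ∷ q) (suc t) (s≤s t≤) (c<d ∷ l) =
  ≤-trans (≤-reflexive (+-suc c t)) (≤-trans (+-monoˡ-≤ t c<d) (linked-growth d q t t≤ l))

increasing-good : ∀ {r b u v} → Increasing (suc r) (suc b) u v → RightGood r (suc b ∷ u ++ v) (suc (length u))
increasing-good {r} (stop {b = b} b<r _) = [-] , subst (b <_) (sym (+-comm r 1)) b<r
increasing-good {r} (next {c = c} {u} {v} b<c i) = let l , h = increasing-good i in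
  b<c ∷ l , subst ((suc c ∷ u ++ v) ! suc (length u) <_) (sym (+-suc r _)) h

-- Since `rightEnd` tests only the last letter against `red`, a longer increasing run that passes
-- through a non-subexcedent letter and becomes subexcedent again must be excluded. Along such a run
-- letters grow by at least one per step and `red` by at most one, so it never recovers.
increasing-max : ∀ {r b u v} → Increasing (suc r) (suc b) u v → ∀ t → suc (length u) < t →
                 t ≤ length (suc b ∷ u ++ v) → ¬ RightGood r (suc b ∷ u ++ v) t
increasing-max {r} (next {c = c} {u} {v} b<c i) (suc (suc t)) (s≤s u<t) (s≤s t≤) (b<c′ ∷ l , h) =
  increasing-max i (suc t) u<t t≤ (l , subst ((suc c ∷ u ++ v) ! suc t <_) (+-suc r _) h)
increasing-max (stop _ _) 1 (s≤s ()) _ _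
increasing-max (stop {v = []} _ _) (suc (suc t)) _ (s≤s ()) _
increasing-max (stop {v = 0 ∷ v} _ _) (suc (suc t)) _ _ (() ∷ _ , _)
increasing-max {r} (stop {b = b} {v = suc c ∷ v} _ below) (suc (suc t)) _ (s≤s (s≤s t≤)) (b<c ∷ l , h) with suc c ≤? suc r
... | yes c≤r = <⇒≯ b<c (subst (λ x → onHead (Below b) (x ∷ marks 0 (suc (suc r)) v)) (mark-s c≤r) below)
... | no  c≰r = c≰r (+-cancelʳ-≤ t (suc c) (suc r) (≤-pred (begin
    suc (suc c + t)                                ≤⟨ s≤s (linked-growth (suc c) v t t≤ l) ⟩
    suc ((suc c ∷ v) ! suc t)                      ≤⟨ h ⟩
    r + suc (suc (length (Pos (take t v))))        ≤⟨ +-monoʳ-≤ r (s≤s (s≤s (≤-trans (length-Pos-≤ (take t v)) (≤-trans (≤-reflexive (length-take t v)) (m⊓n≤m t _))))) ⟩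
    r + suc (suc t)                                ≡⟨ trans (+-suc r (suc t)) (cong suc (+-suc r t)) ⟩
    suc (suc r + t)                                ∎)))
  where open ≤-Reasoning

-- b ∷ u is a decreasing run of positive letters ending in a.
data Decreasing (a : ℕ) : ℕ → Word → Set where
  stop : Decreasing a a []
  next : ∀ {b c u} → suc c < b → Decreasing a (suc c) u → Decreasing a b (suc c ∷ u)

-- The run has no zeros, so the single zero left by `marks 1` is the one behind it. Letters fall
-- while reduced positions increase, so subexcedence of the first letter passes to all.
decreasing-slide : ∀ {a b u r q} → Decreasing a b u → b ≤ r → onHead (Above a) (marks 0 (r + length u) q) →
                   SlideLeft b (marks 1 r (u ++ 0 ∷ q)) (marks 0 r (u ++ q))
decreasing-slide {r = r} {q} stop _ above = stop (subst (λ r → onHead _ (marks 0 r q)) (+-identityʳ r) above)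
decreasing-slide {a} {r = r} {q} (next {c = c} {u} c<b d) b≤r above
  rewrite mark-s {r} {suc c} (≤-trans (<⇒≤ c<b) b≤r) =
  next c<b (decreasing-slide d (≤-trans (<⇒≤ c<b) (m≤n⇒m≤1+n b≤r))
    (subst (λ r → onHead (Above a) (marks 0 r q)) (+-suc r (length u)) above))

decreasing-linked : ∀ {a b u} → Decreasing a b u → Linked _>_ (b ∷ u)
decreasing-linked stop         = [-]
decreasing-linked (next c<b d) = c<b ∷ decreasing-linked d

length-Pos-decreasing : ∀ {a b u} → Decreasing a b u → length (Pos u) ≡ length u
length-Pos-decreasing stop       = refl
length-Pos-decreasing (next _ d) = cong suc (length-Pos-decreasing d)

-- w, preceded by r positive letters, ends in a decreasing run of subexcedent
-- letters with last letter a.  In the case whole, the run may extend beyond w.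
data LeftSplit (r a : ℕ) (w : Word) : Set where
  whole : ∀ b u → w ≡ suc b ∷ u → suc b ≤ r → Decreasing a (suc b) u → LeftSplit r a w
  split : ∀ t b u → w ≡ t ++ suc b ∷ u → suc b ≤ r + length (Pos t) → Decreasing a (suc b) u →
          (∀ y → Below (suc b) (lastOr y (marks (zeros t) r t))) → LeftSplit r a w

-- The run grows leftwards as the recursion returns, until a zero, a non-subexcedent letter or a
-- smaller letter stops it. The stopping letter lies inside `t`, so the condition on it holds for
-- every `y` preceding the word.
leftSplit : ∀ r p a → suc a ≤ r + length (Pos p) → NoRepeat (Pos (p ∷ʳ suc a)) → LeftSplit r (suc a) (p ∷ʳ suc a)
leftSplit r [] a a≤ nr = whole a [] refl (subst (suc a ≤_) (+-identityʳ r) a≤) stop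
leftSplit r (0 ∷ p) a a≤ nr with leftSplit r p a a≤ nr
... | whole b u w≡ b≤ d      = split [ 0 ] b u (cong (0 ∷_) w≡) (subst (suc b ≤_) (sym (+-identityʳ r)) b≤) d (λ _ → tt)
... | split t b u w≡ b≤ d bd = split (0 ∷ t) b u (cong (0 ∷_) w≡) b≤ d (λ _ → bd z)
leftSplit r (suc x ∷ p) a a≤ nr with leftSplit (suc r) p a (subst (suc a ≤_) (+-suc r _) a≤) (Linked.tail nr)
... | split t b u w≡ b≤ d bd =
  split (suc x ∷ t) b u (cong (suc x ∷_) w≡) (subst (suc b ≤_) (sym (+-suc r _)) b≤) d (λ _ → bd (mark r (suc x)))
... | whole b u w≡ b≤ d with suc x ≤? r | <-cmp (suc x) (suc b)
...   | yes x≤r | tri> _ _ b<x = whole x (suc b ∷ u) (cong (suc x ∷_) w≡) x≤r (next b<x d)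
...   | yes x≤r | tri≈ _ x≡b _ with x≢b ∷ _ ← subst (λ v → NoRepeat (suc x ∷ Pos v)) w≡ nr = contradiction x≡b x≢b
...   | yes x≤r | tri< x<b _ _ =
  split [ suc x ] b u (cong (suc x ∷_) w≡) (subst (suc b ≤_) (+-comm 1 r) b≤) d
    (λ _ → subst (Below (suc b)) (sym (mark-s x≤r)) x<b)
...   | no  x≰r | _ =
  split [ suc x ] b u (cong (suc x ∷_) w≡) (subst (suc b ≤_) (+-comm 1 r) b≤) d
    (λ _ → subst (Below (suc b)) (sym (mark-e (≰⇒> x≰r))) tt)

-- A decreasing word whose first letter is subexcedent consists of subexcedent
-- letters, so it cannot extend a maximal run.
decreasing-max : ∀ r d t b u l y → Linked _>_ ((d ∷ t) ++ b ∷ u) → d ≤ r → ¬ Below b (lastOr y (marks l r (d ∷ t)))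
decreasing-max r zero    []      b u l y (() ∷ _)
decreasing-max r zero    (_ ∷ _) b u l y (() ∷ _)
decreasing-max r (suc d) []      b u l y (b<d ∷ _) d≤r h =
  <⇒≯ b<d (subst (Below b) (mark-s d≤r) h)
decreasing-max r (suc d) (c ∷ t) b u l y (c<d ∷ ls) d≤r h =
  decreasing-max (suc r) c t b u l (mark r (suc d)) ls (≤-trans (<⇒≤ c<d) (m≤n⇒m≤1+n d≤r)) h

linked-++⁻ʳ : ∀ {A : Set} {R : A → A → Set} xs {ys} → Linked R (xs ++ ys) → Linked R ys
linked-++⁻ʳ []           l = l
linked-++⁻ʳ (x ∷ xs) l = linked-++⁻ʳ xs (Linked.tail l)

linked-++⁻ˡ : ∀ {A : Set} {R : A → A → Set} xs {ys} → Linked R (xs ++ ys) → Linked R xs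
linked-++⁻ˡ []           l       = []
linked-++⁻ˡ (x ∷ [])     l       = [-]
linked-++⁻ˡ (x ∷ y ∷ xs) (r ∷ l) = r ∷ linked-++⁻ˡ (y ∷ xs) l

!-++-suc : ∀ (u v : Word) t → (u ++ v) ! (length u + suc t) ≡ v ! suc t
!-++-suc []          v t = refl
!-++-suc (_ ∷ [])    v t = refl
!-++-suc (_ ∷ y ∷ u) v t = !-++-suc (y ∷ u) v t

++-∷ : ∀ (u : Word) x v → u ++ x ∷ v ≡ (u ∷ʳ x) ++ v
++-∷ u x v = sym (++-assoc u [ x ] v)

zeros-++ : ∀ u v → zeros (u ++ v) ≡ zeros u + zeros v
zeros-++ []          v = refl
zeros-++ (0 ∷ u)     v = cong suc (zeros-++ u v)
zeros-++ (suc _ ∷ u) v = zeros-++ u v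

-- The action of moveZero on a given zero

module _ (p q : Word) where

  private
    w = p ++ 0 ∷ q
    j = suc (length p)
    r = length (Pos p)

    length-w : length w ≡ j + length q
    length-w = trans (length-++ p) (+-suc (length p) (length q))

    before : w [ 1 ⋯ length p ] ≡ p
    before = factor [] p (0 ∷ q) refl refl refl

    module _ {t} (t≤ : t ≤ length q) where

      private
        |take| : length (take t q) ≡ t
        |take| = trans (length-take t q) (m≤n⇒m⊓n≡m t≤)

        w≡ : w ≡ (p ∷ʳ 0) ++ take t q ++ drop t q
        w≡ = trans (++-∷ p 0 q) (cong ((p ∷ʳ 0) ++_) (sym (take++drop≡id t q)))

      after-take : w [ suc j ⋯ j + t ] ≡ take t q
      after-take = factor (p ∷ʳ 0) (take t q) (drop t q) w≡
        (cong suc (sym (length-snoc p 0))) (cong₂ _+_ (sym (length-snoc p 0)) (sym |take|))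

      red-after : red w (j + t) ≡ r + length (Pos (take t q))
      red-after = trans (red-at ((p ∷ʳ 0) ++ take t q) (drop t q) (trans w≡ (sym (++-assoc (p ∷ʳ 0) (take t q) (drop t q))))
          (trans (cong₂ _+_ (sym (length-snoc p 0)) (sym |take|)) (sym (length-++ (p ∷ʳ 0)))))
        (trans (length-Pos-++ (p ∷ʳ 0) (take t q)) (cong (λ v → length v + length (Pos (take t q))) (Pos-snoc-0 p)))

    letter-after : ∀ t → w ! (j + suc t) ≡ q ! suc t
    letter-after t = trans (cong₂ _!_ (++-∷ p 0 q) (cong (_+ suc t) (sym (length-snoc p 0)))) (!-++-suc (p ∷ʳ 0) q t)

  letter-right : w ! suc j ≡ q ! 1
  letter-right = trans (cong (w !_) (+-comm 1 j)) (letter-after 0)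

  rightEnd≡ : ∀ {b u v} → q ≡ suc b ∷ u ++ v → Increasing (suc r) (suc b) u v → rightEnd w j ≡ j + suc (length u)
  rightEnd≡ {b} {u} {v} refl i = cong (fromMaybe 0) (last-filter
    (λ k → (suc j ≤? k) ×-dec linked? _<?_ (w [ suc j ⋯ k ]) ×-dec (w ! k <? red w k))
    (length w) (j + suc (length u)) z<s (subst (j + suc (length u) ≤_) (sym length-w) (+-monoʳ-≤ j u≤))
    (good u≤ (increasing-good i)) bad)
    where
    u≤ : suc (length u) ≤ length q
    u≤ = s≤s (length-++-≤ˡ u)

    Good : ℕ → Set
    Good k = suc j ≤ k × Linked _<_ (w [ suc j ⋯ k ]) × w ! k < red w k

    good : ∀ {t} → suc t ≤ length q → RightGood r q (suc t) → Good (j + suc t)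
    good {t} t≤ (l , h) = ≤-trans (≤-reflexive (+-comm 1 j)) (+-monoʳ-≤ j (s≤s z≤n)) ,
      subst (Linked _<_) (sym (after-take t≤)) l ,
      subst₂ _<_ (sym (letter-after t)) (sym (red-after t≤)) h

    bad : ∀ k → j + suc (length u) < k → k ≤ length w → ¬ Good k
    bad k <k k≤ (_ , l , h) with m≤n⇒∃[o]m+o≡n (≤-trans (m≤m+n j _) (<⇒≤ <k))
    ... | zero , refl = <⇒≱ <k (+-monoʳ-≤ j z≤n)
    ... | suc t , refl = increasing-max i (suc t) (+-cancelˡ-< j _ _ <k) t≤
        (subst (Linked _<_) (after-take t≤) l , subst₂ _<_ (letter-after t) (red-after t≤) h)
      where
      t≤ : suc t ≤ length q
      t≤ = +-cancelˡ-≤ j _ _ (subst (j + suc t ≤_) length-w k≤)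

  moveRight≡ : ∀ {b u v} → q ≡ suc b ∷ u ++ v → Increasing (suc r) (suc b) u v →
               moveRight w j ≡ p ++ suc b ∷ u ++ 0 ∷ v
  moveRight≡ {b} {u} {v} refl i rewrite rightEnd≡ refl i = cong₂ _++_ before
    (cong₂ (λ x y → x ++ 0 ∷ y)
      (factor (p ∷ʳ 0) (suc b ∷ u) v (++-∷ p 0 q) (cong suc (sym (length-snoc p 0))) (cong (_+ suc (length u)) (sym (length-snoc p 0))))
      (factor (p ++ 0 ∷ suc b ∷ u) v [] (trans (cong (p ++_) (cong (λ v → 0 ∷ suc b ∷ u ++ v) (sym (++-identityʳ v)))) (sym (++-assoc p (0 ∷ suc b ∷ u) (v ++ []))))
        (cong suc (sym length-t)) (trans length-w (trans (cong (j +_) (length-++ (suc b ∷ u))) (trans (sym (+-assoc j _ _)) (cong (_+ length v) (sym length-t)))))))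
    where
    length-t : length (p ++ 0 ∷ suc b ∷ u) ≡ j + suc (length u)
    length-t = trans (length-++ p) (+-suc (length p) _)

  leftEnd≡ : ∀ {t b u a} → p ≡ t ++ suc b ∷ u → suc b ≤ length (Pos t) → Decreasing a (suc b) u →
             Below (suc b) (lastOr z (marks (zeros t) 0 t)) → leftEnd w j ≡ suc (length t)
  leftEnd≡ {t} {b} {u} refl b≤ d below = cong (fromMaybe 0) (head-filter
    (λ i → (i ≤? j ∸ 1) ×-dec linked? _>?_ (w [ i ⋯ j ∸ 1 ]) ×-dec (red w i >? w ! i))
    suc (length w) (length t) (≤-trans t<p (length-++-≤ˡ p))
    (good t b u refl (decreasing-linked d) b≤)
    bad)
    where
    t<p : suc (length t) ≤ length p
    t<p = subst (suc (length t) ≤_) (sym (trans (length-++ t) (+-suc (length t) (length u)))) (s≤s (m≤m+n (length t) (length u)))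

    Good : ℕ → Set
    Good i = i ≤ length p × Linked _>_ (w [ i ⋯ length p ]) × red w i > w ! i

    module _ (s : Word) (c : ℕ) (v : Word) (p≡ : p ≡ s ++ c ∷ v) where
      length-p : length p ≡ length s + suc (length v)
      length-p = trans (cong length p≡) (length-++ s)

      w≡ : w ≡ s ++ (c ∷ v) ++ 0 ∷ q
      w≡ = trans (cong (_++ 0 ∷ q) p≡) (++-assoc s (c ∷ v) (0 ∷ q))

      suffix : w [ suc (length s) ⋯ length p ] ≡ c ∷ v
      suffix = factor s (c ∷ v) (0 ∷ q) w≡ refl length-p

      letter : w ! suc (length s) ≡ c
      letter = letter-at s c (v ++ 0 ∷ q) w≡ refl

      red≡ : red w (suc (length s)) ≡ length (Pos s) + length (Pos [ c ])
      red≡ = trans (red-at (s ∷ʳ c) (v ++ 0 ∷ q) (trans w≡ (++-∷ s c (v ++ 0 ∷ q))) (sym (length-snoc s c)))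
                   (length-Pos-++ s [ c ])

    good : ∀ s c v (p≡ : p ≡ s ++ suc c ∷ v) → Linked _>_ (suc c ∷ v) → suc c ≤ length (Pos s) → Good (suc (length s))
    good s c v p≡ l c≤ =
      subst (suc (length s) ≤_) (sym (trans (length-p s (suc c) v p≡) (+-suc (length s) _))) (s≤s (m≤m+n (length s) _)) ,
      subst (Linked _>_) (sym (suffix s (suc c) v p≡)) l ,
      subst₂ _<_ (sym (letter s (suc c) v p≡)) (sym (trans (red≡ s (suc c) v p≡) (+-comm _ 1))) (s≤s c≤)

    split-at : ∀ (t : Word) i → i < length t → ∃[ s ] ∃[ c ] ∃[ v ] t ≡ s ++ c ∷ v × length s ≡ i
    split-at (x ∷ t) zero    _ = [] , x , t , refl , refl
    split-at (x ∷ t) (suc i) (s≤s i<) with split-at t i i<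
    ... | s , c , v , refl , refl = x ∷ s , c , v , refl , refl

    bad : ∀ i → i < length t → ¬ Good (suc i)
    bad i i<t (_ , l , h) with split-at t i i<t
    ... | s , c , v , t≡ , refl = decreasing-max (length (Pos s)) c v (suc b) u (zeros (c ∷ v)) (lastOr z (marks (zeros s) 0 s))
        (subst (Linked _>_) (suffix s c (v ++ suc b ∷ u) p≡) l) c≤
        (subst (Below (suc b)) last≡ below)
      where
      p≡ : t ++ suc b ∷ u ≡ s ++ c ∷ v ++ suc b ∷ u
      p≡ = trans (cong (_++ suc b ∷ u) t≡) (++-assoc s (c ∷ v) (suc b ∷ u))
      c≤ : c ≤ length (Pos s)
      c≤ = ≤-pred (≤-trans (subst₂ _<_ (letter s c (v ++ suc b ∷ u) p≡) (red≡ s c (v ++ suc b ∷ u) p≡) h)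
             (≤-trans (+-monoʳ-≤ (length (Pos s)) (length-Pos-≤ [ c ])) (≤-reflexive (+-comm _ 1))))
      zeros≡ : zeros t ≡ zeros s + zeros (c ∷ v)
      zeros≡ = trans (cong zeros t≡) (zeros-++ s (c ∷ v))
      last≡ : lastOr z (marks (zeros t) 0 t) ≡ lastOr (lastOr z (marks (zeros s) 0 s)) (marks (zeros (c ∷ v)) (length (Pos s)) (c ∷ v))
      last≡ = trans (cong (lastOr z) (trans (cong₂ (λ l t → marks l 0 t) zeros≡ t≡) (marks-++ (zeros (c ∷ v)) 0 s (c ∷ v))))
                    (lastOr-++ z (marks (zeros s) 0 s) _)

  moveLeft≡ : ∀ {t b u a} → p ≡ t ++ suc b ∷ u → suc b ≤ length (Pos t) → Decreasing a (suc b) u →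
              Below (suc b) (lastOr z (marks (zeros t) 0 t)) → moveLeft w j ≡ t ++ 0 ∷ (suc b ∷ u) ++ q
  moveLeft≡ {t} {b} {u} refl b≤ d below rewrite leftEnd≡ {t} refl b≤ d below =
    cong₂ _++_ (factor [] t ((suc b ∷ u) ++ 0 ∷ q) w≡ refl refl)
      (cong (0 ∷_) (cong₂ _++_ (factor t (suc b ∷ u) (0 ∷ q) w≡ refl (length-++ t))
        (factor (p ∷ʳ 0) q [] (trans (++-∷ p 0 q) (cong ((p ∷ʳ 0) ++_) (sym (++-identityʳ q))))
          (cong suc (sym (length-snoc p 0))) (trans length-w (cong (_+ length q) (sym (length-snoc p 0)))))))
    where
    w≡ : w ≡ t ++ (suc b ∷ u) ++ 0 ∷ q
    w≡ = ++-assoc t (suc b ∷ u) (0 ∷ q)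

onHead-nonSub⇒above : ∀ {a} T → onHead NonSub T → onHead (Above a) T
onHead-nonSub⇒above []          _ = tt
onHead-nonSub⇒above (z* ∷ _)    _ = tt
onHead-nonSub⇒above (exc _ ∷ _) _ = tt

mark-nonSub : ∀ r x → ¬ x ≤ r → NonSub (mark r x)
mark-nonSub r x x≰r rewrite mark-e (≰⇒> x≰r) = tt

onHead-mark-nonSub : ∀ r x {T} → ¬ x ≤ r → onHead NonSub (mark r x ∷ T)
onHead-mark-nonSub r x x≰r rewrite mark-e (≰⇒> x≰r) = tt

red-right : ∀ p b q → red (p ++ 0 ∷ b ∷ q) (suc (suc (length p))) ≡ length (Pos p) + length (Pos [ b ])
red-right p b q = trans
  (red-at (p ++ 0 ∷ b ∷ []) q (sym (++-assoc p (0 ∷ b ∷ []) q)) (sym (trans (length-++ p) (+-comm (length p) 2))))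
  (length-Pos-++ p (0 ∷ b ∷ []))

right-sub : ∀ p q → Subexcedent (p ++ 0 ∷ q) (suc (suc (length p))) →
            ∃[ b ] ∃[ q′ ] q ≡ suc b ∷ q′ × suc b ≤ length (Pos p)
right-sub p q (0<x , x<red) with q | letter-right p q
... | []         | e with () ← subst (0 <_) e 0<x
... | 0 ∷ _      | e with () ← subst (0 <_) e 0<x
... | suc b ∷ q′ | e = b , q′ , refl ,
  ≤-pred (subst (suc (suc b) ≤_) (+-comm _ 1) (subst₂ _<_ e (red-right p (suc b) q′) x<red))

right-nonSub : ∀ p q → ¬ Subexcedent (p ++ 0 ∷ q) (suc (suc (length p))) → onHead NonSub (marks 0 (length (Pos p)) q)
right-nonSub p []          _ = tt
right-nonSub p (0 ∷ q)     _ = tt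
right-nonSub p (suc b ∷ q) h = onHead-mark-nonSub (length (Pos p)) (suc b) λ b≤ →
  h (subst (0 <_) (sym (letter-right p (suc b ∷ q))) z<s ,
     subst₂ _<_ (sym (letter-right p (suc b ∷ q))) (sym (trans (red-right p (suc b) q) (+-comm _ 1))) (s≤s b≤))

module _ (p : Word) (a : ℕ) (q : Word) where

  private
    w = (p ∷ʳ a) ++ 0 ∷ q

  letter-left : w ! length (p ∷ʳ a) ≡ a
  letter-left = letter-at p a (0 ∷ q) (sym (++-∷ p a (0 ∷ q))) (length-snoc p a)

  red-left : red w (length (p ∷ʳ a)) ≡ length (Pos p) + length (Pos [ a ])
  red-left = trans (red-at (p ∷ʳ a) (0 ∷ q) refl refl) (length-Pos-++ p [ a ])

lastOr-snoc : ∀ p a → lastOr z (marks (zeros (p ∷ʳ suc a)) 0 (p ∷ʳ suc a)) ≡ mark (length (Pos p)) (suc a)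
lastOr-snoc p a = trans
  (cong (lastOr z) (trans (cong (λ l → marks l 0 (p ∷ʳ suc a)) (zeros-++ p [ suc a ])) (marks-++ 0 0 p [ suc a ])))
  (lastOr-++ z (marks (zeros p) 0 p) _)

lastOr-snoc-0 : ∀ p → lastOr z (marks (zeros (p ∷ʳ 0)) 0 (p ∷ʳ 0)) ≡ z
lastOr-snoc-0 p = trans
  (cong (lastOr z) (trans (cong (λ l → marks l 0 (p ∷ʳ 0)) (zeros-++ p [ 0 ])) (marks-++ 1 0 p [ 0 ])))
  (lastOr-++ z (marks (zeros p) 0 p) _)

left-sub : ∀ p q → Subexcedent (p ++ 0 ∷ q) (length p) →
           ∃[ p′ ] ∃[ a ] p ≡ p′ ∷ʳ suc a × suc a ≤ length (Pos p′)
left-sub p q h with initLast p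
left-sub .[] q (() , _) | []
... | p′ ∷ʳ′ zero with () ← subst (0 <_) (letter-left p′ 0 q) (proj₁ h)
... | p′ ∷ʳ′ suc a = p′ , a , refl ,
  ≤-pred (subst (suc (suc a) ≤_) (+-comm _ 1) (subst₂ _<_ (letter-left p′ (suc a) q) (red-left p′ (suc a) q) (proj₂ h)))

left-nonSub : ∀ p q → ¬ Subexcedent (p ++ 0 ∷ q) (length p) → NonSub (lastOr z (marks (zeros p) 0 p))
left-nonSub p q h with initLast p
... | [] = tt
... | p′ ∷ʳ′ zero = subst NonSub (sym (lastOr-snoc-0 p′)) tt
... | p′ ∷ʳ′ suc a = subst NonSub (sym (lastOr-snoc p′ a)) (mark-nonSub (length (Pos p′)) (suc a) λ a≤ →
  h (subst (0 <_) (sym (letter-left p′ (suc a) q)) z<s ,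
     subst₂ _<_ (sym (letter-left p′ (suc a) q)) (sym (trans (red-left p′ (suc a) q) (+-comm _ 1))) (s≤s a≤)))

zeros-decreasing : ∀ {a b u} → Decreasing a b u → zeros u ≡ 0
zeros-decreasing stop       = refl
zeros-decreasing (next _ d) = zeros-decreasing d

module _ (p q : Word) (nr : NoRepeat (Pos (p ++ 0 ∷ q))) where

  private
    w = p ++ 0 ∷ q
    P = marks (zeros p) 0 p
    Q = marks 0 (length (Pos p)) q

  -- The zero at hand is number `zeros p + 1` from the left. Sliding over positive letters does not
  -- change this number, so lowering the count of unmoved zeros by one turns exactly this `z` into
  -- `z*`.
  Moves : Word → Set
  Moves w′ = Move z (marks (suc (zeros p)) 0 w) (marks (zeros p) 0 w′)

  private
    nr′ : NoRepeat (Pos p ++ Pos q)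
    nr′ = subst NoRepeat (Pos-++ p (0 ∷ q)) nr

    marks-w : marks (suc (zeros p)) 0 w ≡ P ++ z ∷ Q
    marks-w = trans (cong (λ l → marks l 0 w) (+-comm 1 (zeros p))) (marks-++ 1 0 p (0 ∷ q))

    marks-p : ∀ v → marks (zeros p) 0 (p ++ v) ≡ P ++ marks 0 (length (Pos p)) v
    marks-p v = trans (cong (λ l → marks l 0 (p ++ v)) (sym (+-identityʳ (zeros p)))) (marks-++ 0 0 p v)

    from-zero : ∀ v → Move (lastOr z P) (z ∷ Q) (marks 0 (length (Pos p)) v) → Moves (p ++ v)
    from-zero v m = subst₂ (Move z) (sym marks-w) (sym (marks-p v)) (move-skip P (marks-unmoved 0 p) m)

  stays : NonSub (lastOr z P) → onHead NonSub Q → Moves w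
  stays l r = from-zero (0 ∷ q) (stay l r)

  moves-right : ∀ {b q′} → q ≡ suc b ∷ q′ → suc b ≤ length (Pos p) → Above (suc b) (lastOr z P) →
                Moves (moveRight w (suc (length p)))
  moves-right {b} {q′} refl b≤ above
    with increasing (suc (length (Pos p))) (suc b) q′ (s≤s b≤) (linked-++⁻ʳ (Pos p) nr′)
  ... | u , v , refl , i rewrite moveRight≡ p q refl i = from-zero (suc b ∷ u ++ 0 ∷ v)
    (subst (λ x → Move (lastOr z P) (z ∷ x ∷ marks 0 (suc (length (Pos p))) (u ++ v)) (x ∷ marks 0 (suc (length (Pos p))) (u ++ 0 ∷ v)))
      (sym (mark-s b≤)) (right above (increasing-slide i)))

  moves-left : ∀ {p′ a} → p ≡ p′ ∷ʳ suc a → suc a ≤ length (Pos p′) → onHead (Above (suc a)) Q →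
               Moves (moveLeft w (suc (length p)))
  moves-left {p′} {a} refl a≤ above with leftSplit 0 p′ a a≤ (linked-++⁻ˡ (Pos p) nr′)
  -- The case `whole` would need a positive letter at most 0: the first positive letter of a word is
  -- never subexcedent, so some letter precedes the run.
  ... | split t b u p≡ b≤ d below rewrite moveLeft≡ p q p≡ b≤ d (below z) =
    subst₂ (Move z) (sym from≡) (sym to≡) (move-skip (marks (zeros t) 0 t) (marks-unmoved 0 t)
      (subst (λ x → Move _ (x ∷ marks 1 (suc rt) (u ++ 0 ∷ q)) (z* ∷ x ∷ marks 0 (suc rt) (u ++ q)))
        (sym (mark-s b≤)) (left (below z) (decreasing-slide d (m≤n⇒m≤1+n b≤) (subst (λ r → onHead (Above (suc a)) (marks 0 r q)) rp≡ above)))))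
    where
    rt = length (Pos t)
    rp≡ : length (Pos p) ≡ suc rt + length u
    rp≡ = trans (cong (length ∘ Pos) p≡) (trans (length-Pos-++ t (suc b ∷ u))
      (trans (cong (λ l → rt + suc l) (length-Pos-decreasing d)) (+-suc rt (length u))))
    zeros≡ : zeros p ≡ zeros t + 0
    zeros≡ = trans (cong zeros p≡) (trans (zeros-++ t (suc b ∷ u)) (cong (zeros t +_) (zeros-decreasing d)))
    from≡ : marks (suc (zeros p)) 0 w ≡ marks (zeros t) 0 t ++ marks 1 rt (suc b ∷ u ++ 0 ∷ q)
    from≡ = trans (cong₂ (λ l v → marks l 0 v)
                    (trans (cong suc zeros≡) (sym (+-suc (zeros t) 0)))
                    (trans (cong (_++ 0 ∷ q) p≡) (++-assoc t (suc b ∷ u) (0 ∷ q))))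
                  (marks-++ 1 0 t (suc b ∷ u ++ 0 ∷ q))
    to≡ : marks (zeros p) 0 (t ++ 0 ∷ (suc b ∷ u) ++ q) ≡ marks (zeros t) 0 t ++ z* ∷ marks 0 rt (suc b ∷ u ++ q)
    to≡ = trans (cong (λ l → marks l 0 (t ++ 0 ∷ (suc b ∷ u) ++ q)) zeros≡) (marks-++ 0 0 t (0 ∷ suc b ∷ u ++ q))

  moveZero-move : Moves (moveZero (suc (length p)) w)
  moveZero-move with subexcedent? w (length p) | subexcedent? w (suc (suc (length p)))
  ... | no ¬l | no ¬r = stays (left-nonSub p q ¬l) (right-nonSub p q ¬r)
  ... | no ¬l | yes r = let b , q′ , q≡ , b≤ = right-sub p q r in
    moves-right q≡ b≤ (nonSub⇒above _ (left-nonSub p q ¬l))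
  ... | yes l | no ¬r = let p′ , a , p≡ , a≤ = left-sub p q l in
    moves-left p≡ a≤ (onHead-nonSub⇒above Q (right-nonSub p q ¬r))
  ... | yes l | yes r with left-sub p q l | right-sub p q r
  ...   | p′ , a , refl , a≤ | b , q′ , refl , b≤ with <-cmp (w ! length p) (w ! suc (suc (length p)))
  ...     | tri< a<b _ _ = moves-left refl a≤ (subst (λ x → onHead (Above (suc a)) (x ∷ marks 0 (suc (length (Pos p))) q′)) (sym (mark-s b≤))
                             (subst₂ _<_ (letter-left p′ (suc a) q) (letter-right p q) a<b))
  ...     | tri> _ _ b<a = moves-right refl b≤ (subst (Above (suc b)) (sym (trans (lastOr-snoc p′ a) (mark-s a≤)))
                             (subst₂ _<_ (letter-right p q) (letter-left p′ (suc a) q) b<a))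
  -- The two neighbours of the zero become adjacent in the positive subword, where equal neighbours
  -- are excluded.
  ...     | tri≈ _ a≡b _ = contradiction (trans (sym (letter-left p′ (suc a) q)) (trans a≡b (letter-right p q)))
    (Linked.head (linked-++⁻ʳ (Pos p′) (subst NoRepeat
      (trans (cong (_++ Pos q) (Pos-snoc-suc p′ a)) (++-assoc (Pos p′) [ suc a ] (Pos q))) nr′)))

-- The maps φ and 𝚽

length-Zero-from : ∀ i w → length (Zero-from i w) ≡ zeros w
length-Zero-from i []          = refl
length-Zero-from i (0 ∷ w)     = cong suc (length-Zero-from (suc i) w)
length-Zero-from i (suc _ ∷ w) = length-Zero-from (suc i) w

zero#≡zeros : ∀ w → zero# w ≡ zeros w
zero#≡zeros w = trans (cong length (Zero≡ w)) (length-Zero-from 1 w)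

split-zero : ∀ i w l → l < zeros w →
             ∃[ p ] ∃[ q ] w ≡ p ++ 0 ∷ q × zeros p ≡ l × Zero-from i w ! suc l ≡ i + length p
split-zero i (suc x ∷ w) l l< with split-zero (suc i) w l l<
... | p , q , refl , refl , h = suc x ∷ p , q , refl , refl , trans h (sym (+-suc i (length p)))
split-zero i (0 ∷ w) zero    _ = [] , w , refl , refl , sym (+-identityʳ i)
split-zero i (0 ∷ w) (suc l) (s≤s l<) with split-zero (suc i) w l l<
... | p , q , refl , refl , h = 0 ∷ p , q , refl , refl , trans h (sym (+-suc i (length p)))

zeros+length-Pos : ∀ w → zeros w + length (Pos w) ≡ length w
zeros+length-Pos []          = refl
zeros+length-Pos (0 ∷ w)     = cong suc (zeros+length-Pos w)
zeros+length-Pos (suc _ ∷ w) = trans (+-suc _ _) (cong suc (zeros+length-Pos w))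

-- Covers the indices beyond the number of zeros, at which `φ` is the identity.
marks-saturate : ∀ l r w → zeros w ≤ l → marks (suc l) r w ≡ marks l r w
marks-saturate l       r []          _       = refl
marks-saturate (suc l) r (0 ∷ w)     (s≤s h) = cong (z ∷_) (marks-saturate l r w h)
marks-saturate l       r (suc x ∷ w) h       = cong (mark r (suc x) ∷_) (marks-saturate l (suc r) w h)

data φ-Action (l : ℕ) (w : Word) : Word → Set where
  moved   : ∀ {w′} → suc l ≤ zeros w → Move z (marks (suc l) 0 w) (marks l 0 w′) → φ-Action l w w′
  unmoved : zeros w ≤ l → φ-Action l w w

φ-action : ∀ l w → NoRepeat (Pos w) → φ-Action l w (φ (suc l) w)
φ-action l w nr with suc l ≤? zeros w
... | no  l≥ = subst (φ-Action l w) (sym (cong (if_then moveZero (Zero w ! suc l) w else w)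
                 (dec-false (suc l ≤? zero# w) (l≥ ∘ subst (suc l ≤_) (zero#≡zeros w))))) (unmoved (≮⇒≥ l≥))
... | yes l< with split-zero 1 w l l<
...   | p , q , refl , refl , h = subst (φ-Action l w) (sym (trans
    (cong (if_then moveZero (Zero w ! suc l) w else w) (dec-true (suc l ≤? zero# w) (subst (suc l ≤_) (sym (zero#≡zeros w)) l<)))
    (cong (λ j → moveZero j w) (trans (cong (_! suc l) (Zero≡ w)) h)))) (moved l< (moveZero-move p q nr))

action-Pos : ∀ {l w w′} → φ-Action l w w′ → Pos w′ ≡ Pos w
action-Pos (unmoved _) = refl
action-Pos {l} {w} {w′} (moved _ m) =
  trans (cong Pos (sym (unmark-marks l 0 w′))) (trans (move-Pos m) (cong Pos (unmark-marks (suc l) 0 w)))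

length-marks : ∀ l r w → length (marks l r w) ≡ length w
length-marks l r w = trans (sym (length-map unmark (marks l r w))) (cong length (unmark-marks l r w))

action-length : ∀ {l w w′} → φ-Action l w w′ → length w′ ≡ length w
action-length (unmoved _) = refl
action-length {l} {w} {w′} (moved _ m) =
  trans (sym (length-marks l 0 w′)) (trans (move-length m) (length-marks (suc l) 0 w))

action-pattern : ∀ {l w w′} → φ-Action l w w′ →
                 pattern-from rise z (marks (suc l) 0 w) ≡ pattern-from rise z (marks l 0 w′)
action-pattern {l} {w} (unmoved h) = cong (pattern-from rise z) (marks-saturate l 0 w h)
action-pattern (moved _ m) = move-pattern _ m

-- Equal length and equal positive subword give equally many zeros, so `φ` either moves a zero in
-- both words or in neither.
action-injective : ∀ {l w₁ w₂ w′} → Pos w₁ ≡ Pos w₂ → length w₁ ≡ length w₂ →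
                   φ-Action l w₁ w′ → φ-Action l w₂ w′ → w₁ ≡ w₂
action-injective {l} {w₁} {w₂} p≡ l≡ = cases
  where
  zeros≡ : zeros w₁ ≡ zeros w₂
  zeros≡ = +-cancelʳ-≡ (length (Pos w₁)) (zeros w₁) (zeros w₂)
    (trans (zeros+length-Pos w₁) (trans l≡ (trans (sym (zeros+length-Pos w₂)) (cong (λ v → zeros w₂ + length v) (sym p≡)))))
  cases : ∀ {w′} → φ-Action l w₁ w′ → φ-Action l w₂ w′ → w₁ ≡ w₂
  cases (unmoved _)  (unmoved _)  = refl
  cases (unmoved h)  (moved l< _) = contradiction (subst (_≤ l) zeros≡ h) (<⇒≱ l<)
  cases (moved l< _) (unmoved h)  = contradiction h (<⇒≱ (subst (suc l ≤_) zeros≡ l<))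
  cases (moved _ m₁) (moved _ m₂) = marks-injective w₁ w₂ (move-injective m₁ m₂)

φ-upTo : ℕ → Word → Word
φ-upTo zero    w = w
φ-upTo (suc n) w = φ-upTo n (φ (suc n) w)

foldr-φ : ∀ n w → foldr φ w [1⋯ n ] ≡ φ-upTo n w
foldr-φ zero    w = refl
foldr-φ (suc n) w = trans (cong (foldr φ w) (sym (applyUpTo-∷ʳ suc n)))
  (trans (foldr-++ φ w [1⋯ n ] [ suc n ]) (foldr-φ n (φ (suc n) w)))

𝚽≡φ-upTo : ∀ w → 𝚽 w ≡ φ-upTo (length w) w
𝚽≡φ-upTo w = foldr-φ (length w) w

φ-upTo-Pos-length : ∀ n w → NoRepeat (Pos w) → Pos (φ-upTo n w) ≡ Pos w × length (φ-upTo n w) ≡ length w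
φ-upTo-Pos-length zero    w nr = refl , refl
φ-upTo-Pos-length (suc n) w nr =
  let a = φ-action n w nr
      ihP , ihL = φ-upTo-Pos-length n (φ (suc n) w) (subst NoRepeat (sym (action-Pos a)) nr)
  in trans ihP (action-Pos a) , trans ihL (action-length a)

-- Each step turns one more zero into a moved one at unchanged pattern; the chain leads from the
-- order of the word, with all zeros original, to that of the permutation, with all zeros moved.
φ-upTo-pattern : ∀ n w → NoRepeat (Pos w) →
  pattern-from rise z (marks n 0 w) ≡ pattern-from rise z (marks 0 0 (φ-upTo n w))
φ-upTo-pattern zero    w nr = refl
φ-upTo-pattern (suc n) w nr =
  let a = φ-action n w nr in
  trans (action-pattern a) (φ-upTo-pattern n (φ (suc n) w) (subst NoRepeat (sym (action-Pos a)) nr))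

φ-upTo-injective : ∀ n w₁ w₂ → NoRepeat (Pos w₁) → Pos w₁ ≡ Pos w₂ → length w₁ ≡ length w₂ →
                     φ-upTo n w₁ ≡ φ-upTo n w₂ → w₁ ≡ w₂
φ-upTo-injective zero    w₁ w₂ nr p≡ l≡ h = h
φ-upTo-injective (suc n) w₁ w₂ nr p≡ l≡ h =
  let a₁ = φ-action n w₁ nr
      a₂ = φ-action n w₂ (subst NoRepeat p≡ nr)
      φ≡ = φ-upTo-injective n _ _ (subst NoRepeat (sym (action-Pos a₁)) nr)
             (trans (action-Pos a₁) (trans p≡ (sym (action-Pos a₂))))
             (trans (action-length a₁) (trans l≡ (sym (action-length a₂)))) h
  in action-injective p≡ l≡ a₁ (subst (φ-Action n w₂) (sym φ≡) a₂)

derangement-noRepeat : ∀ {v} → Derangement v → NoRepeat v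
derangement-noRepeat {v} (derangement perm _) = Linked.AllPairs⇒Linked
  (Permutationₛ.Unique-resp-↭ (setoid ℕ) (↭⇒↭ₛ (↭-sym perm)) (AllPairs.map <⇒≢ (sorted-[1⋯] (length v))))

-- The two maps on the image of `ZDer` and the three identities

derWord-cong : ∀ {n w w′} → Pos w′ ≡ Pos w → length w′ ≡ length w → DerWord n w → DerWord n w′
derWord-cong p≡ l≡ (derWord len der) = derWord (trans l≡ len) (subst Derangement (sym p≡) der)

module _ {n w} (w∈ : DerWord n w) where

  open DerWord w∈

  𝚽-Pos : Pos (𝚽 w) ≡ Pos w
  𝚽-Pos = trans (cong Pos (𝚽≡φ-upTo w)) (proj₁ (φ-upTo-Pos-length (length w) w (derangement-noRepeat der)))

  𝚽-length : length (𝚽 w) ≡ length w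
  𝚽-length = trans (cong length (𝚽≡φ-upTo w)) (proj₂ (φ-upTo-Pos-length (length w) w (derangement-noRepeat der)))

  𝚽-DerWord : DerWord n (𝚽 w)
  𝚽-DerWord = derWord-cong 𝚽-Pos 𝚽-length w∈

  𝐅₃-DerWord : DerWord n (𝐅₃ w)
  𝐅₃-DerWord = derWord-cong (Pos-𝐅₃ w) (length-𝐅₃ w) w∈

pattern-𝚽 : ∀ {n w} → DerWord n w → pattern-of w ≡ pattern-of (ZDer⁻¹ (𝚽 w))
pattern-𝚽 {n} {w} w∈@(derWord refl der) = trans (pattern-unmoved w∈)
  (trans (cong tail (trans (φ-upTo-pattern n w (derangement-noRepeat der))
    (cong (pattern-from rise z ∘ marks 0 0) (sym (𝚽≡φ-upTo w))))) (sym (pattern-moved (𝚽-DerWord w∈))))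

𝚽-injective : ∀ {n w w′} → DerWord n w → DerWord n w′ → 𝚽 w ≡ 𝚽 w′ → w ≡ w′
𝚽-injective {n} {w} {w′} w∈@(derWord len der) w′∈@(derWord len′ _) h =
  φ-upTo-injective n w w′ (derangement-noRepeat der)
    (trans (sym (𝚽-Pos w∈)) (trans (cong Pos h) (𝚽-Pos w′∈)))
    (trans len (sym len′))
    (subst₂ (λ m m′ → φ-upTo m w ≡ φ-upTo m′ w′) len len′
      (trans (sym (𝚽≡φ-upTo w)) (trans h (𝚽≡φ-upTo w′))))

fix-Der : ∀ {n} (σ τ : Perm n) → Der (word σ) ≡ Der (word τ) → fix (word σ) ≡ fix (word τ)
fix-Der {n} (σ , σ↭) (τ , τ↭) Der≡ = +-cancelʳ-≡ (length (Der σ)) (fix σ) (fix τ)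
  (trans (FromPerm.fix+length-Der σ↭) (trans (sym (FromPerm.fix+length-Der τ↭)) (cong (λ v → fix τ + length v) (sym Der≡))))

theorem1p4 : ∀ (n : ℕ) →
  Σ[ Φ↔ ∈ Inverse (𝔖 n) (𝔖 n) ] Σ[ F₃↔ ∈ Inverse (𝔖 n) (𝔖 n) ]
    -- Φ↔ is Φ and F₃↔ is F₃, and ZDer⁻¹ is applied inside the image of ZDer
    (∀ (σ : Perm n) →
       word (to Φ↔ σ) ≡ Φ (word σ) ×
       ZDer (word (to Φ↔ σ)) ≡ 𝚽 (ZDer (word σ))) ×
    (∀ (σ : Perm n) →
       word (to F₃↔ σ) ≡ F₃ (word σ) ×
       ZDer (word (to F₃↔ σ)) ≡ 𝐅₃ (ZDer (word σ))) ×
    (∀ (σ : Perm n) →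
       (fix (word σ) , RIZE (word σ) , Der (word σ)) ≡
       (fix (word (to Φ↔ σ)) , RISE (word (to Φ↔ σ)) , Der (word (to Φ↔ σ)))) ×
    (∀ (σ : Perm n) →
       (fix (word σ) , maz (word σ) , Der (word σ)) ≡
       (fix (word (to F₃↔ σ)) , maf (word (to F₃↔ σ)) , Der (word (to F₃↔ σ)))) ×
    (∀ (σ : Perm n) →
       (fix (word σ) , maj (word σ) , Der (word σ)) ≡
       (fix (word (to F₃↔ (from Φ↔ σ))) ,
        maf (word (to F₃↔ (from Φ↔ σ))) ,
        Der (word (to F₃↔ (from Φ↔ σ)))))
theorem1p4 n = Φ′.inverse , F′.inverse ,
  (λ σ → refl , Φ′.ZDer-f σ) , (λ σ → refl , F′.ZDer-f σ) , rize , maz-maf , maj-maf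
  where
  module Φ′ = Conjugate {n} 𝚽 𝚽-DerWord 𝚽-injective
  module F′ = Conjugate {n} 𝐅₃ 𝐅₃-DerWord (λ _ _ → 𝐅₃-injective)

  ZDer∈ : ∀ (σ : Perm n) → DerWord n (ZDer (word σ))
  ZDer∈ (_ , σ↭) = FromPerm.ZDer-DerWord σ↭

  Der-Φ : ∀ σ → Der (word σ) ≡ Der (word (Φ′.f σ))
  Der-Φ σ = sym (trans (cong Pos (Φ′.ZDer-f σ)) (𝚽-Pos (ZDer∈ σ)))

  Der-F₃ : ∀ σ → Der (word σ) ≡ Der (word (F′.f σ))
  Der-F₃ σ = sym (trans (cong Pos (F′.ZDer-f σ)) (Pos-𝐅₃ (ZDer (word σ))))

  maz-F₃ : ∀ σ → maz (word σ) ≡ maf (word (F′.f σ))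
  maz-F₃ σ = sym (trans (cong mafz (F′.ZDer-f σ)) (mafz-𝐅₃ (ZDer (word σ))))

  rize : ∀ σ → (fix (word σ) , RIZE (word σ) , Der (word σ)) ≡
               (fix (word (Φ′.f σ)) , RISE (word (Φ′.f σ)) , Der (word (Φ′.f σ)))
  rize σ = cong₂ _,_ (fix-Der σ (Φ′.f σ) (Der-Φ σ)) (cong₂ _,_
    (trans (RISE-pattern 1 (ZDer (word σ))) (trans (cong (rises-from 1) (pattern-𝚽 (ZDer∈ σ))) (sym (RISE-pattern 1 (word (Φ′.f σ))))))
    (Der-Φ σ))

  -- The pattern determines the descents as well as the rises. Applied to the preimage of a
  -- permutation under `Φ`, this replaces its `maj` by the `maz` of the preimage, on which the
  -- identity for `F₃` acts.
  maz-Φ : ∀ σ → maz (word σ) ≡ maj (word (Φ′.f σ))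
  maz-Φ σ = cong sum (trans (DES-pattern 1 (ZDer (word σ)))
    (trans (cong (descents-from 1) (pattern-𝚽 (ZDer∈ σ))) (sym (DES-pattern 1 (word (Φ′.f σ))))))

  maz-maf : ∀ σ → (fix (word σ) , maz (word σ) , Der (word σ)) ≡
                  (fix (word (F′.f σ)) , maf (word (F′.f σ)) , Der (word (F′.f σ)))
  maz-maf σ = cong₂ _,_ (fix-Der σ (F′.f σ) (Der-F₃ σ)) (cong₂ _,_ (maz-F₃ σ) (Der-F₃ σ))

  maj-maf : ∀ σ → (fix (word σ) , maj (word σ) , Der (word σ)) ≡
    (fix (word (F′.f (from Φ′.inverse σ))) , maf (word (F′.f (from Φ′.inverse σ))) , Der (word (F′.f (from Φ′.inverse σ))))
  maj-maf σ = trans (cong (λ s → fix s , maj s , Der s) (sym Φτ≡σ))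
    (trans (cong₂ _,_ (sym (fix-Der τ (Φ′.f τ) (Der-Φ τ))) (cong₂ _,_ (sym (maz-Φ τ)) (sym (Der-Φ τ)))) (maz-maf τ))
    where
    τ = from Φ′.inverse σ
    Φτ≡σ : word (Φ′.f τ) ≡ word σ
    Φτ≡σ = Inverse.strictlyInverseˡ Φ′.inverse σ
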